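{- Let $\mathbf{Mat}_\bullet$ be the category of (possibly infinite) pointed matroids with pointed strong maps. Let $\mathfrak{M}$ be the class of all pointed strong maps which factor as $N \xrightarrow{\sim} M|S \xrightarrow{i_S} M$ (an isomorphism followed by the inclusion of a pointed restriction), and let $\mathfrak{E}$ be the class of all pointed strong maps which factor as $M \xrightarrow{c_S} M/S \xrightarrow{\sim} N$ (the canonical map to a pointed contraction followed by an isomorphism). Then the triple $(\mathbf{Mat}_\bullet, \mathfrak{M}, \mathfrak{E})$ is a proto-exact category, with admissible monomorphisms $\mathfrak{M}$ and admissible epimorphisms $\mathfrak{E}$.
   Context: Matroids. A collection $\mathcal{A}$ of subsets of a set $E$ has Property (M) if for all $A \in \mathcal{A}$ and all $S$ with $A \subseteq S \subseteq E$ the collection $\{X \in \mathcal{A} : A \subseteq X \subseteq S\}$ has an inclusion-maximal element. A (possibly infinite) matroid $M$ on a ground set $E = E(M)$ is given by its set $\mathcal{C}$ of circuits, a collection of subsets of $E$ satisfying: (C0) $\emptyset \notin \mathcal{C}$; (CI) distinct elements of $\mathcal{C}$ are incomparable under inclusion; (CE) for all $X \subseteq C \in \mathcal{C}$, all families $\{C_x \in \mathcal{C} : x \in X\}$ such that for $x,y\in X$ one has $x \in C_y$ iff $x = y$, and all $z \in C \setminus \bigcup_{x} C_x$, there is $C' \in \mathcal{C}$ with $z \in C' \subseteq (C \cup \bigcup_x C_x) \setminus X$; (CM) the collection $\{I \subseteq E : C \not\subseteq I \text{ for all } C \in \mathcal{C}\}$ has Property (M). The closure operator is $\mathrm{cl}_M(X)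 = X \cup \{e \in E : \text{there is a circuit } C \text{ with } e \in C \subseteq X \cup \{e\}\}$. A loop is an element of $\mathrm{cl}_M(\emptyset)$ (equivalently $\{e\}$ is a circuit). A pointed matroid is a matroid with a distinguished loop $\ast$. Strong maps. A strong map $M \to N$ of matroids is a map $f\colon E(M) \to E(N)$ with $f(\mathrm{cl}_M(A)) \subseteq \mathrm{cl}_N(f(A))$ for all $A \subseteq E(M)$ (equivalently, preimages of closed sets of $N$ are closed in $M$). It is pointed if $f(\ast_M)=\ast_N$. Restriction and contraction. For a matroid $M$ with circuit set $\mathcal{C}$ and $S \subseteq E(M)$: the restriction $M|S$ is the matroid on $S$ with circuits $\{C \in \mathcal{C} : C \subseteq S\}$; the contraction $M/S$ is the matroid on $E(M) \setminus S$ whose circuits are the nonempty inclusion-minimal elements of $\{C \setminus S : C \in \mathcal{C}\}$. For pointed matroids only pointed restrictions ($M|S$ with $\ast \in S$) and pointed contractions ($M/S$ with $\ast \notin S$) are considered, with the same distinguished loop. The map $i_S\colon M|S \to M$ is the inclusion $S \hookrightarrow E(M)$; the map $c_S\colon M \to M/S$ sends every element of $S$ to $\ast$ and is the identity on $E(M)\setminus S$. Proto-exact categories. A proto-exact category is a pointed category (one with a zero object $0$) equipped with two classes of morphisms, admissible monomorphisms $\mathfrak{M}$ and admissible epimorphisms $\mathfrak{E}$, such that: (1) every morphism $0 \to M$ is in $\mathfrak{M}$ and every morphism $M \to 0$ is in $\mathfrak{E}$; (2) $\mathfrak{M}$ and $\mathfrak{E}$ are closed under composition and contain all isomorphisms;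 (3) a commutative square with top $i\colon M \to N$, left $j\colon M \to M'$, right $j'\colon N \to N'$, bottom $i'\colon M' \to N'$ (so $j' i = i' j$), where $i,i' \in \mathfrak{M}$ and $j,j' \in \mathfrak{E}$, is Cartesian if and only if it is co-Cartesian; (4) every diagram $M' \xrightarrow{i'} N' \xleftarrow{j'} N$ with $i' \in \mathfrak{M}$, $j' \in \mathfrak{E}$ can be completed to a bi-Cartesian square of the form in (3) with $i \in \mathfrak{M}$, $j \in \mathfrak{E}$; (5) every diagram $M' \xleftarrow{j} M \xrightarrow{i} N$ with $i \in \mathfrak{M}$, $j \in \mathfrak{E}$ can be completed to a bi-Cartesian square of the form in (3) with $i' \in \mathfrak{M}$, $j' \in \mathfrak{E}$. -}

module Defs where

open import Level using (Level; _⊔_; 0ℓ) renaming (suc to lsuc)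
open import Data.Bool.Base using (Bool; false; T; not)
open import Data.Bool.Properties using (T?)
open import Data.Product.Base using (Σ; Σ-syntax; ∃; ∃-syntax; _×_; _,_; proj₁; proj₂)
open import Data.Sum.Base using (inj₁; inj₂; [_,_]′)
open import Function.Base using (_∘_; id)
open import Function.Bundles using (_⇔_)
open import Relation.Binary.Core using (Rel)
open import Relation.Binary.Definitions using (_Respects_)
open import Relation.Binary.Structures using (IsEquivalence)
open import Relation.Binary.PropositionalEquality using (_≡_; refl; sym; trans; cong; _≗_)
open import Relation.Nullary using (¬_; yes; no)
open import Relation.Unary using
  (Pred; _∈_; _⊆_; _∪_; _∖_; ∅; ｛_｝; ⋃; Satisfiable)

------------------------------------------------------------------------
-- Categories (with hom-setoids)

record Category (o h e : Level) : Set (lsuc (o ⊔ h ⊔ e)) where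
  infix  4 _≈_ _⇒_
  infixr 9 _∙_
  field
    Obj       : Set o
    _⇒_       : Rel Obj h
    _≈_       : ∀ {A B} → Rel (A ⇒ B) e
    idm       : ∀ {A} → A ⇒ A
    _∙_       : ∀ {A B C} → B ⇒ C → A ⇒ B → A ⇒ C
    equiv     : ∀ {A B} → IsEquivalence (_≈_ {A} {B})
    ∙-resp-≈  : ∀ {A B C} {f f′ : B ⇒ C} {g g′ : A ⇒ B} →
                f ≈ f′ → g ≈ g′ → f ∙ g ≈ f′ ∙ g′
    assoc     : ∀ {A B C D} {f : A ⇒ B} {g : B ⇒ C} {k : C ⇒ D} →
                (k ∙ g) ∙ f ≈ k ∙ (g ∙ f)
    identityˡ : ∀ {A B} {f : A ⇒ B} → idm ∙ f ≈ f
    identityʳ : ∀ {A B} {f : A ⇒ B} → f ∙ idm ≈ f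

fullSubcategory : ∀ {o h e o′} (C : Category o h e) {I : Set o′} →
                  (I → Category.Obj C) → Category o′ h e
fullSubcategory C {I} U = record
  { Obj       = I
  ; _⇒_       = λ A B → U A ⇒ U B
  ; _≈_       = _≈_
  ; idm       = idm
  ; _∙_       = _∙_
  ; equiv     = equiv
  ; ∙-resp-≈  = ∙-resp-≈
  ; assoc     = assoc
  ; identityˡ = identityˡ
  ; identityʳ = identityʳ
  }
  where open Category C

module _ {o h e : Level} (C : Category o h e) where
  open Category C

  IsIso : ∀ {A B} → A ⇒ B → Set (h ⊔ e)
  IsIso {A} {B} f = Σ[ g ∈ B ⇒ A ] (g ∙ f ≈ idm × f ∙ g ≈ idm)

  IsInitial IsTerminal IsZero : Obj → Set (o ⊔ h ⊔ e)
  IsInitial Z  = ∀ A → Σ[ f ∈ Z ⇒ A ] (∀ g → g ≈ f)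
  IsTerminal Z = ∀ A → Σ[ f ∈ A ⇒ Z ] (∀ g → g ≈ f)
  IsZero Z     = IsInitial Z × IsTerminal Z

  -- In the three definitions below the square is
  --
  --        i
  --    M -----> N
  --    |        |
  --  j |        | j′
  --    v   i′   v
  --    M′ ----> N′

  module _ {M N M′ N′ : Obj}
           (i : M ⇒ N) (j : M ⇒ M′) (j′ : N ⇒ N′) (i′ : M′ ⇒ N′) where

    Commutes : Set e
    Commutes = j′ ∙ i ≈ i′ ∙ j

    IsCartesian : Set (o ⊔ h ⊔ e)
    IsCartesian = Commutes ×
      (∀ {Q} (p : Q ⇒ N) (q : Q ⇒ M′) → j′ ∙ p ≈ i′ ∙ q →
       Σ[ u ∈ Q ⇒ M ] (i ∙ u ≈ p × j ∙ u ≈ q ×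
         (∀ v → i ∙ v ≈ p → j ∙ v ≈ q → v ≈ u)))

    IsCoCartesian : Set (o ⊔ h ⊔ e)
    IsCoCartesian = Commutes ×
      (∀ {Q} (p : N ⇒ Q) (q : M′ ⇒ Q) → p ∙ i ≈ q ∙ j →
       Σ[ u ∈ N′ ⇒ Q ] (u ∙ j′ ≈ p × u ∙ i′ ≈ q ×
         (∀ v → v ∙ j′ ≈ p → v ∙ i′ ≈ q → v ≈ u)))

    IsBiCartesian : Set (o ⊔ h ⊔ e)
    IsBiCartesian = IsCartesian × IsCoCartesian

  MorphismClass : (p : Level) → Set (o ⊔ h ⊔ lsuc p)
  MorphismClass p = ∀ A B → Pred (A ⇒ B) p

  record IsProtoExact {p q} (𝔐 : MorphismClass p) (𝔈 : MorphismClass q)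
         : Set (o ⊔ h ⊔ e ⊔ p ⊔ q) where
    field
      𝔐-resp-≈ : ∀ {A B} {f g : A ⇒ B} → f ≈ g → f ∈ 𝔐 _ _ → g ∈ 𝔐 _ _
      𝔈-resp-≈ : ∀ {A B} {f g : A ⇒ B} → f ≈ g → f ∈ 𝔈 _ _ → g ∈ 𝔈 _ _

      𝟎        : Obj
      𝟎-isZero : IsZero 𝟎

      𝟎⇒-∈𝔐 : ∀ {M} (f : 𝟎 ⇒ M) → f ∈ 𝔐 _ _
      ⇒𝟎-∈𝔈 : ∀ {M} (f : M ⇒ 𝟎) → f ∈ 𝔈 _ _

      𝔐-iso : ∀ {A B} (f : A ⇒ B) → IsIso f → f ∈ 𝔐 _ _
      𝔈-iso : ∀ {A B} (f : A ⇒ B) → IsIso f → f ∈ 𝔈 _ _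
      𝔐-∙   : ∀ {A B C} {f : A ⇒ B} {g : B ⇒ C} → f ∈ 𝔐 _ _ → g ∈ 𝔐 _ _ → g ∙ f ∈ 𝔐 _ _
      𝔈-∙   : ∀ {A B C} {f : A ⇒ B} {g : B ⇒ C} → f ∈ 𝔈 _ _ → g ∈ 𝔈 _ _ → g ∙ f ∈ 𝔈 _ _

      cartesian⇔coCartesian :
        ∀ {M N M′ N′} (i : M ⇒ N) (j : M ⇒ M′) (j′ : N ⇒ N′) (i′ : M′ ⇒ N′) →
        i ∈ 𝔐 _ _ → i′ ∈ 𝔐 _ _ → j ∈ 𝔈 _ _ → j′ ∈ 𝔈 _ _ → Commutes i j j′ i′ →
        IsCartesian i j j′ i′ ⇔ IsCoCartesian i j j′ i′

      completeCospan :
        ∀ {N M′ N′} (j′ : N ⇒ N′) (i′ : M′ ⇒ N′) → i′ ∈ 𝔐 _ _ → j′ ∈ 𝔈 _ _ →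
        Σ[ M ∈ Obj ] Σ[ i ∈ M ⇒ N ] Σ[ j ∈ M ⇒ M′ ]
          (i ∈ 𝔐 _ _ × j ∈ 𝔈 _ _ × IsBiCartesian i j j′ i′)

      completeSpan :
        ∀ {M N M′} (i : M ⇒ N) (j : M ⇒ M′) → i ∈ 𝔐 _ _ → j ∈ 𝔈 _ _ →
        Σ[ N′ ∈ Obj ] Σ[ j′ ∈ N ⇒ N′ ] Σ[ i′ ∈ M′ ⇒ N′ ]
          (i′ ∈ 𝔐 _ _ × j′ ∈ 𝔈 _ _ × IsBiCartesian i j j′ i′)

------------------------------------------------------------------------
-- Subsets

-- The power set, by characteristic functions.  Assuming excluded middle at
-- level ℓ, every Pred E ℓ (for E : Set ℓ) is of the form ⟦ A ⟧ up to
-- equivalence.  Bool-valued subsets keep the power set in Set ℓ, and make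
-- membership proof-irrelevant, so that Elem A really is a subset of E.

Subset : ∀ {ℓ} → Set ℓ → Set ℓ
Subset E = E → Bool

⟦_⟧ : ∀ {ℓ} {E : Set ℓ} → Subset E → Pred E 0ℓ
⟦ A ⟧ e = T (A e)

Elem : ∀ {ℓ} {E : Set ℓ} → Subset E → Set ℓ
Elem A = ∃ ⟦ A ⟧

∁ : ∀ {ℓ} {E : Set ℓ} → Subset E → Subset E
∁ A = not ∘ A

image : ∀ {a b p} {E : Set a} {F : Set b} → (E → F) → Pred E p → Pred F (a ⊔ b ⊔ p)
image f A y = ∃[ x ] (x ∈ A × f x ≡ y)

------------------------------------------------------------------------
-- Matroids

-- Circuit-resp expresses extensionality: subsets with the same elements
-- are the same subset.

record CircuitSystem (ℓ : Level) : Set (lsuc ℓ) where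
  field
    E            : Set ℓ
    Circuit      : Pred (Subset E) ℓ
    Circuit-resp : Circuit Respects _≗_

  Independent : Pred (Subset E) ℓ
  Independent I = ∀ C → Circuit C → ¬ (⟦ C ⟧ ⊆ ⟦ I ⟧)

  cl : ∀ {p} → Pred E p → Pred E (ℓ ⊔ p)
  cl X = X ∪ λ e → ∃[ C ] (Circuit C × e ∈ ⟦ C ⟧ × ⟦ C ⟧ ⊆ X ∪ ｛ e ｝)

  Loop : Pred E ℓ
  Loop e = e ∈ cl ∅

PropertyM : ∀ {ℓ} {E : Set ℓ} → Pred (Subset E) ℓ → Set ℓ
PropertyM 𝒜 = ∀ A S → 𝒜 A → ⟦ A ⟧ ⊆ ⟦ S ⟧ →
  ∃[ B ] (Between A S B × (∀ X → Between A S X → ⟦ B ⟧ ⊆ ⟦ X ⟧ → ⟦ X ⟧ ⊆ ⟦ B ⟧))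
  where
  Between = λ A S X → 𝒜 X × ⟦ A ⟧ ⊆ ⟦ X ⟧ × ⟦ X ⟧ ⊆ ⟦ S ⟧

record IsMatroid {ℓ} (M : CircuitSystem ℓ) : Set ℓ where
  open CircuitSystem M
  field
    C0 : ¬ Circuit (λ _ → false)
    CI : ∀ C D → Circuit C → Circuit D → ⟦ C ⟧ ⊆ ⟦ D ⟧ → C ≗ D
    CE : ∀ C → Circuit C → (X : Subset E) → ⟦ X ⟧ ⊆ ⟦ C ⟧ →
         (D : Elem X → Subset E) → (∀ x → Circuit (D x)) →
         (∀ x y → proj₁ x ∈ ⟦ D y ⟧ ⇔ x ≡ y) →
         ∀ z → z ∈ ⟦ C ⟧ ∖ ⋃ (Elem X) (λ x → ⟦ D x ⟧) →
         ∃[ C′ ] (Circuit C′ × z ∈ ⟦ C′ ⟧ ×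
                  ⟦ C′ ⟧ ⊆ (⟦ C ⟧ ∪ ⋃ (Elem X) (λ x → ⟦ D x ⟧)) ∖ ⟦ X ⟧)
    CM : PropertyM Independent

record PointedSystem (ℓ : Level) : Set (lsuc ℓ) where
  field
    circuitSystem : CircuitSystem ℓ
  open CircuitSystem circuitSystem public
  field
    ⋆ : E

record PointedMatroid (ℓ : Level) : Set (lsuc ℓ) where
  field
    pointedSystem : PointedSystem ℓ
  open PointedSystem pointedSystem public
  field
    isMatroid : IsMatroid circuitSystem
    ⋆-loop    : Loop ⋆

------------------------------------------------------------------------
-- Pointed strong maps

-- The definition only involves circuits and the point.  Allowing arbitrary
-- pointed systems lets one speak of strong maps into a restriction and out of
-- a contraction without first having to prove that these are matroids.

record StrongMap {ℓ} (M N : PointedSystem ℓ) : Set (lsuc ℓ) where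
  private
    module M = PointedSystem M
    module N = PointedSystem N
  field
    fun     : M.E → N.E
    strong  : (A : Pred M.E ℓ) → image fun (M.cl A) ⊆ N.cl (image fun A)
    pointed : fun M.⋆ ≡ N.⋆

open StrongMap public

module _ {ℓ p q : Level} (M : CircuitSystem ℓ) where
  open CircuitSystem M

  cl-mono : {X : Pred E p} {Y : Pred E q} → X ⊆ Y → cl X ⊆ cl Y
  cl-mono X⊆Y (inj₁ e∈X) = inj₁ (X⊆Y e∈X)
  cl-mono X⊆Y (inj₂ (C , C-circuit , e∈C , C⊆)) =
    inj₂ (C , C-circuit , e∈C , [ inj₁ ∘ X⊆Y , inj₂ ]′ ∘ C⊆)

Sys• : ∀ ℓ → Category (lsuc ℓ) (lsuc ℓ) ℓ
Sys• ℓ = record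
  { Obj       = PointedSystem ℓ
  ; _⇒_       = StrongMap
  ; _≈_       = λ f g → fun f ≗ fun g
  ; idm       = λ {M} → record
    { fun     = id
    ; strong  = λ { A (x , x∈clA , refl) →
                    cl-mono (circuitSystem M) (λ {a} a∈A → a , a∈A , refl) x∈clA }
    ; pointed = refl
    }
  ; _∙_       = λ {_} {_} {P} g f → record
    { fun     = fun g ∘ fun f
    ; strong  = λ { A (x , x∈clA , refl) →
                    cl-mono (circuitSystem P)
                      (λ { (_ , (a , a∈A , refl) , refl) → a , a∈A , refl })
                      (strong g (image (fun f) A)
                        (fun f x , strong f A (x , x∈clA , refl) , refl)) }
    ; pointed = trans (cong (fun g) (pointed f)) (pointed g)
    }
  ; equiv     = record
    { refl  = λ _ → refl
    ; sym   = λ p x → sym (p x)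
    ; trans = λ p q x → trans (p x) (q x)
    }
  ; ∙-resp-≈  = λ {_} {_} {_} {f} {_} {_} {g′} p q x →
                  trans (cong (fun f) (q x)) (p (fun g′ x))
  ; assoc     = λ _ → refl
  ; identityˡ = λ _ → refl
  ; identityʳ = λ _ → refl
  }
  where open PointedSystem using (circuitSystem)

Mat• : ∀ ℓ → Category (lsuc ℓ) (lsuc ℓ) ℓ
Mat• ℓ = fullSubcategory (Sys• ℓ) {PointedMatroid ℓ} PointedMatroid.pointedSystem

------------------------------------------------------------------------
-- Pointed restriction and contraction

module _ {ℓ : Level} (M : PointedSystem ℓ) where
  open PointedSystem M

  restriction : (S : Subset E) → ⋆ ∈ ⟦ S ⟧ → PointedSystem ℓ
  restriction S ⋆∈S = record
    { circuitSystem = record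
      { E            = Elem S
      ; Circuit      = λ D → ∃[ C ] (Circuit C × ⟦ C ⟧ ⊆ ⟦ S ⟧ × D ≗ C ∘ proj₁)
      ; Circuit-resp = λ { D≗D′ (C , C-circuit , C⊆S , D≗C) →
                           C , C-circuit , C⊆S , λ x → trans (sym (D≗D′ x)) (D≗C x) }
      }
    ; ⋆ = ⋆ , ⋆∈S
    }

  i⟨_⟩ : (S : Subset E) → Elem S → E
  i⟨ S ⟩ = proj₁

  -- The sets C ∖ S for C a circuit, as subsets of E ∖ S.
  Trace : (S : Subset E) → Pred (Subset (Elem (∁ S))) ℓ
  Trace S D = ∃[ C ] (Circuit C × D ≗ C ∘ proj₁)

  -- "Nonempty inclusion-minimal" means minimal among the nonempty traces;
  -- the empty trace arises as soon as S contains a circuit.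
  MinimalTrace : (S : Subset E) → Pred (Subset (Elem (∁ S))) ℓ
  MinimalTrace S D = Trace S D × Satisfiable ⟦ D ⟧ ×
    (∀ D′ → Trace S D′ → Satisfiable ⟦ D′ ⟧ → ⟦ D′ ⟧ ⊆ ⟦ D ⟧ → D′ ≗ D)

  MinimalTrace-resp : (S : Subset E) → MinimalTrace S Respects _≗_
  MinimalTrace-resp S {D} {D″} D≗D″ ((C , C-circuit , D≗C) , (x , x∈D) , D-min) =
      (C , C-circuit , λ y → trans (sym (D≗D″ y)) (D≗C y))
    , (x , transport (D≗D″ x) x∈D)
    , λ D′ D′-trace D′-nonempty D′⊆D″ y →
        trans (D-min D′ D′-trace D′-nonempty
                 (λ {w} w∈D′ → transport (sym (D≗D″ w)) (D′⊆D″ w∈D′)) y)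
              (D≗D″ y)
    where
    transport : ∀ {a b} → a ≡ b → T a → T b
    transport refl t = t

  contraction : (S : Subset E) → ⋆ ∈ ⟦ ∁ S ⟧ → PointedSystem ℓ
  contraction S ⋆∉S = record
    { circuitSystem = record
      { E            = Elem (∁ S)
      ; Circuit      = MinimalTrace S
      ; Circuit-resp = MinimalTrace-resp S
      }
    ; ⋆ = ⋆ , ⋆∉S
    }

  c⟨_⟩ : (S : Subset E) → ⋆ ∈ ⟦ ∁ S ⟧ → E → Elem (∁ S)
  c⟨ S ⟩ ⋆∉S e with T? (∁ S e)
  ... | yes e∉S = e , e∉S
  ... | no  _   = ⋆ , ⋆∉S

------------------------------------------------------------------------
-- Admissible morphisms

-- An isomorphism of pointed systems is a pointed strong map with a pointed
-- strong inverse.  The restriction and the contraction are not asked to be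
-- matroids: this is automatic when they are isomorphic to a pointed matroid,
-- since such an isomorphism preserves closure and the circuits of either system
-- are nonempty and incomparable, hence determined by closure.

module _ (ℓ : Level) where

  open PointedMatroid using (E; ⋆; pointedSystem)

  𝔐 : MorphismClass (Mat• ℓ) (lsuc ℓ)
  𝔐 N M f =
    Σ[ S ∈ Subset (E M) ] Σ[ ⋆∈S ∈ ⋆ M ∈ ⟦ S ⟧ ]
    Σ[ φ ∈ StrongMap (pointedSystem N) (restriction (pointedSystem M) S ⋆∈S) ]
      (IsIso (Sys• ℓ) φ × fun f ≗ i⟨_⟩ (pointedSystem M) S ∘ fun φ)

  𝔈 : MorphismClass (Mat• ℓ) (lsuc ℓ)
  𝔈 M N f =
    Σ[ S ∈ Subset (E M) ] Σ[ ⋆∉S ∈ ⋆ M ∈ ⟦ ∁ S ⟧ ]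
    Σ[ φ ∈ StrongMap (contraction (pointedSystem M) S ⋆∉S) (pointedSystem N) ]
      (IsIso (Sys• ℓ) φ × fun f ≗ fun φ ∘ c⟨_⟩ (pointedSystem M) S ⋆∉S)

{-# OPTIONS --safe #-}
module Submission where

-- Everything is expressed through closure.  Circuit elimination amounts to
-- idempotence of cl, and cl of M / S is X ↦ cl (X ∪ S) ∖ S, so that contractions
-- of matroids are matroids.  Admissible monomorphisms are the injective maps
-- that reflect closure; admissible epimorphisms are the surjective maps that
-- are injective off the fibre of ⋆ and reflect closure up to that fibre.
-- For a commutative square as in axiom (3), both the Cartesian and the
-- co-Cartesian property are equivalent to ker j′ ⊆ im i.

open import Level using (Level; Lift; lift; lower) renaming (suc to lsuc)
open import Axiom.ExcludedMiddle using (ExcludedMiddle)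
open import Data.Bool.Base using (Bool; true; false; T)
open import Data.Bool.Properties using (T?; T-≡; T-irrelevant; ⇔→≡)
open import Data.Empty using (⊥; ⊥-elim)
open import Data.Product.Base using (Σ-syntax; ∃-syntax; _×_; _,_; proj₁; proj₂; map₂)
open import Data.Sum.Base using (_⊎_; inj₁; inj₂; [_,_]′)
import Data.Sum.Base as Sum
open import Data.Unit.Polymorphic.Base using (⊤; tt)
open import Function.Base using (_∘_; id; const; case_of_)
open import Function.Bundles using (_⇔_; mk⇔; Equivalence)
open import Function.Construct.Composition using (_⇔-∘_)
open import Function.Construct.Symmetry using (⇔-sym)
open import Relation.Binary.PropositionalEquality
  using (_≡_; _≢_; refl; sym; trans; cong; subst; _≗_)
open import Relation.Nullary using (¬_; yes; no; contradiction)
open import Relation.Nullary.Decidable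
  using (isYes; toWitness; fromWitness; decidable-stable)
open import Relation.Unary
  using (Pred; _∈_; _∉_; _⊆_; _∪_; _∖_; ｛_｝; ⋃; Satisfiable)
open import Defs

-- The delicate half of the closure formula for `M / S` is to find a circuit of the contraction. A
-- circuit of `M` only leaves a trace off `S`, this trace may fail to be minimal, and in an infinite
-- matroid no descent reaches a minimal nonempty trace inside it. Property (M) replaces the descent:
-- it provides bases, and the fundamental circuit with respect to a basis that extends a basis of
-- `S` has a minimal trace. The same bases carry Property (M) over to minors, since a set is
-- independent in `M / S` exactly when it stays independent after a basis of `S` is added.
--
-- Excluded middle enters in two ways: it turns predicates into Bool-valued subsets, to which the
-- matroid axioms apply, and, because it decides untruncated existence statements, membership in the
-- image of a map carries a preimage, from which inverse maps are built.

private variable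
  p q : Level

-- Boolean subsets

T⇔T⇒≡ : ∀ {a b} → (T a → T b) → (T b → T a) → a ≡ b
T⇔T⇒≡ f g = ⇔→≡ (T-≡ ⇔-∘ (mk⇔ f g ⇔-∘ ⇔-sym T-≡))

module _ {a : Level} {E : Set a} where

  ⊆-antisym : {A B : Subset E} → ⟦ A ⟧ ⊆ ⟦ B ⟧ → ⟦ B ⟧ ⊆ ⟦ A ⟧ → A ≗ B
  ⊆-antisym A⊆B B⊆A x = T⇔T⇒≡ A⊆B B⊆A

  ≗⇒⊆ : {A B : Subset E} → A ≗ B → ⟦ A ⟧ ⊆ ⟦ B ⟧
  ≗⇒⊆ A≗B {x} = subst T (A≗B x)

  ∁⇒∉ : (A : Subset E) {x : E} → x ∈ ⟦ ∁ A ⟧ → x ∉ ⟦ A ⟧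
  ∁⇒∉ A {x} x∈∁ x∈A with A x
  ... | true = x∈∁

  ∉⇒∁ : (A : Subset E) {x : E} → x ∉ ⟦ A ⟧ → x ∈ ⟦ ∁ A ⟧
  ∉⇒∁ A {x} x∉A with A x
  ... | true  = ⊥-elim (x∉A _)
  ... | false = _

  Elem-≡ : {A : Subset E} {x y : Elem A} → proj₁ x ≡ proj₁ y → x ≡ y
  Elem-≡ {x = x , t} {.x , u} refl = cong (x ,_) (T-irrelevant t u)

  proj₁∈image⁻ : {A : Subset E} {X : Pred (Elem A) p} {x : Elem A} →
                 proj₁ x ∈ image proj₁ X → x ∈ X
  proj₁∈image⁻ {X = X} (y , y∈X , eq) = subst X (Elem-≡ eq) y∈X

cl-resp-≡ : ∀ {ℓ} (M : CircuitSystem ℓ) {X : Pred (CircuitSystem.E M) p} {x y} → x ≡ y →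
            x ∈ CircuitSystem.cl M X → y ∈ CircuitSystem.cl M X
cl-resp-≡ M refl x∈cl = x∈cl

module _ {ℓ : Level} (em : ExcludedMiddle ℓ) where

  subset : {E : Set ℓ} → Pred E ℓ → Subset E
  subset P x = isYes (em {P x})

  module _ {E : Set ℓ} (P : Pred E ℓ) where

    ∈-subset⁺ : P ⊆ ⟦ subset P ⟧
    ∈-subset⁺ = fromWitness

    ∈-subset⁻ : ⟦ subset P ⟧ ⊆ P
    ∈-subset⁻ = toWitness

  by-contradiction : {P : Set ℓ} → ¬ ¬ P → P
  by-contradiction = decidable-stable em

  -- Closure, circuit elimination and bases

  module Circuits (M : CircuitSystem ℓ) where
    open CircuitSystem M

    circuit⇒cl : {X : Pred E p} {C : Subset E} {e : E} →
                 Circuit C → e ∈ ⟦ C ⟧ → ⟦ C ⟧ ∖ ｛ e ｝ ⊆ X → e ∈ cl X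
    circuit⇒cl {X = X} {C} {e} C-circuit e∈C C∖e⊆X = inj₂ (C , C-circuit , e∈C , C⊆)
      where
      C⊆ : ⟦ C ⟧ ⊆ X ∪ ｛ e ｝
      C⊆ {y} y∈C with em {e ≡ y}
      ... | yes e≡y = inj₂ e≡y
      ... | no  e≢y = inj₁ (C∖e⊆X (y∈C , e≢y))

    Independent-antitone : {I J : Subset E} → ⟦ I ⟧ ⊆ ⟦ J ⟧ → Independent J → Independent I
    Independent-antitone I⊆J J-ind C C-circuit C⊆I = J-ind C C-circuit (I⊆J ∘ C⊆I)

    independent⇒∉cl : {I : Subset E} → Independent I →
                      ∀ {x} → x ∈ ⟦ I ⟧ → x ∉ cl (⟦ I ⟧ ∖ ｛ x ｝)
    independent⇒∉cl I-ind x∈I (inj₁ (_ , x≢x)) = x≢x refl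
    independent⇒∉cl I-ind x∈I (inj₂ (C , C-circuit , _ , C⊆)) =
      I-ind C C-circuit λ y∈C → case C⊆ y∈C of λ where
        (inj₁ (y∈I , _)) → y∈I
        (inj₂ refl)      → x∈I

    ClosureIdempotent : Set (lsuc ℓ)
    ClosureIdempotent = {X Y : Pred E ℓ} → Y ⊆ cl X → cl Y ⊆ cl X

    -- Circuit elimination says that z lies in the closure of
    -- (C ∪ ⋃ D x) ∖ X ∖ {z}: this set spans X through the D x, hence C ∖ {z}.
    closureIdempotent⇒isMatroid :
      ¬ Circuit (λ _ → false) →
      (∀ C D → Circuit C → Circuit D → ⟦ C ⟧ ⊆ ⟦ D ⟧ → C ≗ D) →
      ClosureIdempotent → PropertyM Independent → IsMatroid M
    closureIdempotent⇒isMatroid c0 ci cl-idem cm = record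
      { C0 = c0 ; CI = ci ; CE = ce ; CM = cm }
      where
      ce : ∀ C → Circuit C → (X : Subset E) → ⟦ X ⟧ ⊆ ⟦ C ⟧ →
           (D : Elem X → Subset E) → (∀ x → Circuit (D x)) →
           (∀ x y → proj₁ x ∈ ⟦ D y ⟧ ⇔ x ≡ y) →
           ∀ z → z ∈ ⟦ C ⟧ ∖ ⋃ (Elem X) (λ x → ⟦ D x ⟧) →
           ∃[ C′ ] (Circuit C′ × z ∈ ⟦ C′ ⟧ ×
                    ⟦ C′ ⟧ ⊆ (⟦ C ⟧ ∪ ⋃ (Elem X) (λ x → ⟦ D x ⟧)) ∖ ⟦ X ⟧)
      ce C C-circuit X X⊆C D D-circuit D-iff z (z∈C , z∉D) =
        eliminated (cl-idem C∖z⊆clY (circuit⇒cl C-circuit z∈C id))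
        where
        open Equivalence
        W : Pred E ℓ
        W = (⟦ C ⟧ ∪ ⋃ (Elem X) (λ x → ⟦ D x ⟧)) ∖ ⟦ X ⟧
        Y : Pred E ℓ
        Y = W ∖ ｛ z ｝
        z∉X : z ∉ ⟦ X ⟧
        z∉X z∈X = z∉D ((z , z∈X) , from (D-iff (z , z∈X) _) refl)
        C∖z⊆clY : ⟦ C ⟧ ∖ ｛ z ｝ ⊆ cl Y
        C∖z⊆clY {y} (y∈C , z≢y) with T? (X y)
        ... | no  y∉X = inj₁ ((inj₁ y∈C , y∉X) , z≢y)
        ... | yes y∈X = circuit⇒cl (D-circuit (y , y∈X)) (from (D-iff _ _) refl)
          λ (w∈D , y≢w) → (inj₂ (_ , w∈D) ,
              λ w∈X → y≢w (cong proj₁ (sym (to (D-iff (_ , w∈X) _) w∈D))))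
                        , λ { refl → z∉D (_ , w∈D) }
        eliminated : z ∈ cl Y → ∃[ C′ ] (Circuit C′ × z ∈ ⟦ C′ ⟧ × ⟦ C′ ⟧ ⊆ W)
        eliminated (inj₁ (_ , z≢z)) = contradiction refl z≢z
        eliminated (inj₂ (C′ , C′-circuit , z∈C′ , C′⊆)) =
          C′ , C′-circuit , z∈C′ , λ y∈C′ → case C′⊆ y∈C′ of λ where
            (inj₁ (y∈W , _)) → y∈W
            (inj₂ refl)      → inj₁ z∈C , z∉X

  module Matroid {M : CircuitSystem ℓ} (isM : IsMatroid M) where
    open CircuitSystem M
    open IsMatroid isM
    open Circuits M

    ∅-independent : Independent (λ _ → false)
    ∅-independent C C-circuit C⊆∅ =
      C0 (Circuit-resp (⊆-antisym {A = C} C⊆∅ λ ()) C-circuit)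

    -- Circuit elimination applied to a circuit `C` through `e` inside `Y` and `e`. The set `Z` to
    -- be eliminated consists of the elements of `C` other than `e` that lie outside `X`. Each `c`
    -- in `Z` lies in `Y`, so it has a circuit inside `X` and `c`; as `Z` is disjoint from `X`, this
    -- circuit meets `Z` in `c` alone. It avoids `e` because `e` is neither in `X` nor equal to `c`.
    cl-least : (X : Subset E) {Y : Pred E q} → Y ⊆ cl ⟦ X ⟧ → cl Y ⊆ cl ⟦ X ⟧
    cl-least X Y⊆ (inj₁ e∈Y) = Y⊆ e∈Y
    cl-least X {Y} Y⊆ {e} (inj₂ (C , C-circuit , e∈C , C⊆)) with T? (X e)
    ... | yes e∈X = inj₁ e∈X
    ... | no  e∉X = inj₂ (C′ , C′-circuit , e∈C′ , C′⊆)
      where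
      P : Pred E ℓ
      P c = c ∈ ⟦ C ⟧ × c ∉ ⟦ X ⟧ × e ≢ c
      Z = subset P
      D : (x : Elem Z) →
          ∃[ D ] (Circuit D × proj₁ x ∈ ⟦ D ⟧ × ⟦ D ⟧ ⊆ ⟦ X ⟧ ∪ ｛ proj₁ x ｝)
      D (c , c∈Z) with ∈-subset⁻ P c∈Z
      ... | c∈C , c∉X , e≢c with C⊆ c∈C
      ...   | inj₂ e≡c = contradiction e≡c e≢c
      ...   | inj₁ c∈Y with Y⊆ c∈Y
      ...     | inj₁ c∈X = contradiction c∈X c∉X
      ...     | inj₂ r = r
      D-iff : ∀ x y → proj₁ x ∈ ⟦ proj₁ (D y) ⟧ ⇔ x ≡ y
      D-iff x y = mk⇔ to (λ { refl → proj₁ (proj₂ (proj₂ (D x))) })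
        where
        to : proj₁ x ∈ ⟦ proj₁ (D y) ⟧ → x ≡ y
        to x∈D with proj₂ (proj₂ (proj₂ (D y))) x∈D
        ... | inj₁ x∈X = contradiction x∈X (proj₁ (proj₂ (∈-subset⁻ P (proj₂ x))))
        ... | inj₂ y≡x = Elem-≡ (sym y≡x)
      e∉D : e ∉ ⋃ (Elem Z) (λ x → ⟦ proj₁ (D x) ⟧)
      e∉D (x , e∈D) with proj₂ (proj₂ (proj₂ (D x))) e∈D
      ... | inj₁ e∈X = e∉X e∈X
      ... | inj₂ x≡e = proj₂ (proj₂ (∈-subset⁻ P (proj₂ x))) (sym x≡e)
      elimination = CE C C-circuit Z (λ c∈Z → proj₁ (∈-subset⁻ P c∈Z))
                      (proj₁ ∘ D) (proj₁ ∘ proj₂ ∘ D) D-iff e (e∈C , e∉D)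
      C′ = proj₁ elimination
      C′-circuit = proj₁ (proj₂ elimination)
      e∈C′ = proj₁ (proj₂ (proj₂ elimination))
      C′⊆ : ⟦ C′ ⟧ ⊆ ⟦ X ⟧ ∪ ｛ e ｝
      C′⊆ {y} y∈C′ with proj₂ (proj₂ (proj₂ elimination)) y∈C′
      ... | inj₂ (x , y∈D) , y∉Z with proj₂ (proj₂ (proj₂ (D x))) y∈D
      ...   | inj₁ y∈X  = inj₁ y∈X
      ...   | inj₂ refl = contradiction (proj₂ x) y∉Z
      C′⊆ {y} y∈C′ | inj₁ y∈C , y∉Z with T? (X y) | em {e ≡ y}
      ...   | yes y∈X | _       = inj₁ y∈X
      ...   | no  _   | yes e≡y = inj₂ e≡y
      ...   | no  y∉X | no  e≢y = contradiction (∈-subset⁺ P (y∈C , y∉X , e≢y)) y∉Z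

    cl-idem : {X : Pred E ℓ} {Y : Pred E q} → Y ⊆ cl X → cl Y ⊆ cl X
    cl-idem {X = X} Y⊆clX =
      cl-mono M (∈-subset⁻ X) ∘ cl-least (subset X) (cl-mono M (∈-subset⁺ X) ∘ Y⊆clX)

    -- A maximal independent `B` spans `S`: a circuit inside `B` and `s` must contain `s`, since `B`
    -- is independent, and so puts `s` in the closure of `B`. If `s` is not in that closure, the
    -- enlarged set is independent, and maximality forces `s` into `B` after all.
    basis : ∀ A S → Independent A → ⟦ A ⟧ ⊆ ⟦ S ⟧ →
            ∃[ B ] (Independent B × ⟦ A ⟧ ⊆ ⟦ B ⟧ × ⟦ B ⟧ ⊆ ⟦ S ⟧ × ⟦ S ⟧ ⊆ cl ⟦ B ⟧)
    basis A S A-ind A⊆S with CM A S A-ind A⊆S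
    ... | B , (B-ind , A⊆B , B⊆S) , B-max = B , B-ind , A⊆B , B⊆S , spans
      where
      module _ {s} (s∈S : s ∈ ⟦ S ⟧) (s∉cl : s ∉ cl ⟦ B ⟧) where
        B+s : Pred E ℓ
        B+s = ⟦ B ⟧ ∪ ｛ s ｝
        B+s-ind : Independent (subset B+s)
        B+s-ind C C-circuit C⊆ = B-ind C C-circuit λ y∈C →
          case ∈-subset⁻ B+s (C⊆ y∈C) of λ where
            (inj₁ y∈B)  → y∈B
            (inj₂ refl) → ⊥-elim (s∉cl (inj₂ (C , C-circuit , y∈C , ∈-subset⁻ B+s ∘ C⊆)))
        s∈B : s ∈ ⟦ B ⟧
        s∈B = B-max (subset B+s)
          ( B+s-ind
          , ∈-subset⁺ B+s ∘ inj₁ ∘ A⊆B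
          , [ B⊆S , (λ { refl → s∈S }) ]′ ∘ ∈-subset⁻ B+s )
          (∈-subset⁺ B+s ∘ inj₁)
          (∈-subset⁺ B+s (inj₂ refl))
      spans : ⟦ S ⟧ ⊆ cl ⟦ B ⟧
      spans s∈S = by-contradiction λ s∉cl → s∉cl (inj₁ (s∈B s∈S s∉cl))

  -- Minors of a matroid

  module _ {M : CircuitSystem ℓ} (isM : IsMatroid M) (N : CircuitSystem ℓ) where
    private
      module M = CircuitSystem M
      module N = CircuitSystem N

    open IsMatroid isM using (CM)
    open Matroid isM using (cl-idem)
    open Circuits M using (circuit⇒cl; independent⇒∉cl; Independent-antitone)

    -- Restrictions are the case B = ∅, contractions the case where B is a basis
    -- of the contracted set.
    minor-isMatroid :
      (ι : N.E → M.E) → (∀ {x y} → ι x ≡ ι y → x ≡ y) →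
      (B : Subset M.E) → M.Independent B → (∀ x → ι x ∉ ⟦ B ⟧) →
      (∀ {X : Pred N.E ℓ} {x} → x ∈ N.cl X → ι x ∈ M.cl (image ι X ∪ ⟦ B ⟧)) →
      (∀ {X : Pred N.E ℓ} {x} → ι x ∈ M.cl (image ι X ∪ ⟦ B ⟧) → x ∈ N.cl X) →
      ¬ N.Circuit (λ _ → false) →
      (∀ C D → N.Circuit C → N.Circuit D → ⟦ C ⟧ ⊆ ⟦ D ⟧ → C ≗ D) →
      IsMatroid N
    minor-isMatroid ι ι-inj B B-ind ι∉B cl⁻ cl⁺ c0 ci =
      Circuits.closureIdempotent⇒isMatroid N c0 ci idem cm
      where
      idem : Circuits.ClosureIdempotent N
      idem {X} {Y} Y⊆clX x∈clY = cl⁺ (cl-idem {X = image ι X ∪ ⟦ B ⟧}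
        (λ { (inj₁ (y , y∈Y , refl)) → cl⁻ (Y⊆clX y∈Y)
           ; (inj₂ b∈B)              → inj₁ (inj₂ b∈B) })
        (cl⁻ x∈clY))

      infix 8 _⁺
      _⁺ : Subset N.E → Pred M.E ℓ
      I ⁺ = image ι ⟦ I ⟧ ∪ ⟦ B ⟧

      ι∈⁺ : ∀ I {x} → ι x ∈ I ⁺ → x ∈ ⟦ I ⟧
      ι∈⁺ I (inj₁ (y , y∈I , eq)) = subst (T ∘ I) (ι-inj eq) y∈I
      ι∈⁺ I (inj₂ ιx∈B)           = contradiction ιx∈B (ι∉B _)

      -- A circuit inside `I ⁺` that meets the image of `ι` in `ι x` puts `x` in the `N`-closure of
      -- the rest of `I`; a circuit that misses the image lies in `B`.
      independent⁺ : ∀ I → N.Independent I → M.Independent (subset (I ⁺))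
      independent⁺ I I-ind C C-circuit C⊆ with em {∃[ x ] ι x ∈ ⟦ C ⟧}
      ... | yes (x , ιx∈C) = Circuits.independent⇒∉cl N I-ind (ι∈⁺ I (∈-subset⁻ (I ⁺) (C⊆ ιx∈C)))
        (cl⁺ (circuit⇒cl C-circuit ιx∈C λ (y∈C , ιx≢y) →
          case ∈-subset⁻ (I ⁺) (C⊆ y∈C) of λ where
            (inj₁ (w , w∈I , refl)) → inj₁ (w , (w∈I , λ { refl → ιx≢y refl }) , refl)
            (inj₂ y∈B)              → inj₂ y∈B))
      ... | no ∄ = B-ind C C-circuit λ y∈C →
        case ∈-subset⁻ (I ⁺) (C⊆ y∈C) of λ where
          (inj₁ (w , _ , refl)) → contradiction (w , y∈C) ∄
          (inj₂ y∈B)            → y∈B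

      -- A circuit of `N` inside `I` is nonempty by `c0`, and one of its elements then depends, in
      -- `M`, on the rest of `I ⁺`. That rest still contains `B`, because `ι` avoids `B`.
      independent⁻ : ∀ I → M.Independent (subset (I ⁺)) → N.Independent I
      independent⁻ I I-ind D D-circuit D⊆I with em {Satisfiable ⟦ D ⟧}
      ... | no ∄ = c0 (N.Circuit-resp (⊆-antisym {A = D} (λ x∈D → ∄ (_ , x∈D)) λ ()) D-circuit)
      ... | yes (x , x∈D) = independent⇒∉cl I-ind
        (∈-subset⁺ (I ⁺) (inj₁ (x , D⊆I x∈D , refl)))
        (cl-mono M
          (λ { (inj₁ (y , (y∈D , x≢y) , refl)) →
                 ∈-subset⁺ (I ⁺) (inj₁ (y , D⊆I y∈D , refl)) , x≢y ∘ ι-inj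
             ; (inj₂ b∈B) → ∈-subset⁺ (I ⁺) (inj₂ b∈B) , λ { refl → ι∉B x b∈B } })
          (cl⁻ {X = ⟦ D ⟧ ∖ ｛ x ｝} (Circuits.circuit⇒cl N D-circuit x∈D id)))

      ⁺-mono : ∀ {I J} → ⟦ I ⟧ ⊆ ⟦ J ⟧ → ⟦ subset (I ⁺) ⟧ ⊆ ⟦ subset (J ⁺) ⟧
      ⁺-mono {I} {J} I⊆J x∈ = ∈-subset⁺ (J ⁺) (case ∈-subset⁻ (I ⁺) x∈ of λ where
        (inj₁ (y , y∈I , eq)) → inj₁ (y , I⊆J y∈I , eq)
        (inj₂ x∈B)            → inj₂ x∈B)

      -- A maximal set `J` between `A ⁺` and `S ⁺` contains `B` and otherwise only elements of the
      -- image of `ι`. It is thus determined by its pullback `J ∘ ι`, which inherits maximality.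
      cm : PropertyM N.Independent
      cm A S A-ind A⊆S with CM (subset (A ⁺)) (subset (S ⁺)) (independent⁺ A A-ind) (⁺-mono A⊆S)
      ... | J , (J-ind , A⊆J , J⊆S) , J-max =
          J ∘ ι
        , ( independent⁻ (J ∘ ι) (Independent-antitone J∘ι⁺⊆J J-ind)
          , (λ a∈A → A⊆J (∈-subset⁺ (A ⁺) (inj₁ (_ , a∈A , refl))))
          , (λ x∈J → ι∈⁺ S (∈-subset⁻ (S ⁺) (J⊆S x∈J))) )
        , λ X (X-ind , A⊆X , X⊆S) J⊆X x∈X →
            J-max (subset (X ⁺)) (independent⁺ X X-ind , ⁺-mono A⊆X , ⁺-mono X⊆S)
              (λ j∈J → ∈-subset⁺ (X ⁺) (case ∈-subset⁻ (S ⁺) (J⊆S j∈J) of λ where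
                 (inj₁ (x , _ , refl)) → inj₁ (x , J⊆X j∈J , refl)
                 (inj₂ j∈B)            → inj₂ j∈B))
              (∈-subset⁺ (X ⁺) (inj₁ (_ , x∈X , refl)))
        where
        J∘ι⁺⊆J : ⟦ subset ((J ∘ ι) ⁺) ⟧ ⊆ ⟦ J ⟧
        J∘ι⁺⊆J x∈ = case ∈-subset⁻ ((J ∘ ι) ⁺) x∈ of λ where
          (inj₁ (_ , y∈J , refl)) → y∈J
          (inj₂ x∈B)              → A⊆J (∈-subset⁺ (A ⁺) (inj₂ x∈B))

  -- Matroids in which every element is a loop

  loops : Set ℓ → CircuitSystem ℓ
  loops E = record
    { E            = E
    ; Circuit      = λ C → ∃[ e ] (e ∈ ⟦ C ⟧ × ⟦ C ⟧ ⊆ ｛ e ｝)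
    ; Circuit-resp = λ {C} {D} C≗D (e , e∈C , C⊆e) →
        e , ≗⇒⊆ C≗D e∈C , C⊆e ∘ ≗⇒⊆ {A = D} (sym ∘ C≗D)
    }

  module _ (E : Set ℓ) where
    open CircuitSystem (loops E) using (Circuit; cl; Independent)

    -- Every closure is the whole ground set, so every pointed map into such a matroid is strong.
    -- One loop gives the zero object; two loops give a target for characteristic functions.
    loops-cl : {X : Pred E p} {x : E} → x ∈ cl X
    loops-cl {x = x} = inj₂
      (subset ｛ x ｝ , (x , ∈-subset⁺ ｛ x ｝ refl , ∈-subset⁻ ｛ x ｝)
      , ∈-subset⁺ ｛ x ｝ refl , inj₂ ∘ ∈-subset⁻ ｛ x ｝)

    loops-isMatroid : IsMatroid (loops E)
    loops-isMatroid = Circuits.closureIdempotent⇒isMatroid (loops E)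
      (λ ())
      (λ { C D (c , c∈C , C⊆c) (d , d∈D , D⊆d) C⊆D →
           ⊆-antisym {A = C} C⊆D λ x∈D →
             subst (T ∘ C) (trans (sym (D⊆d (C⊆D c∈C))) (D⊆d x∈D)) c∈C })
      (λ _ _ → loops-cl)
      -- Independent sets are empty, since an element of one yields a singleton circuit inside it;
      -- hence `A` is already maximal.
      λ A S A-ind A⊆S → A , (A-ind , id , A⊆S) ,
        λ X (X-ind , _) _ {x} x∈X → ⊥-elim
          (X-ind (subset ｛ x ｝) (x , ∈-subset⁺ ｛ x ｝ refl , ∈-subset⁻ ｛ x ｝)
            λ y∈x → subst (T ∘ X) (∈-subset⁻ ｛ x ｝ y∈x) x∈X)

    loops• : E → PointedMatroid ℓ
    loops• e = record
      { pointedSystem = record { circuitSystem = loops E ; ⋆ = e }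
      ; isMatroid     = loops-isMatroid
      ; ⋆-loop        = loops-cl
      }

  module Pointed (M : PointedMatroid ℓ) where
    open PointedMatroid M
    open Matroid isMatroid public

    ⋆∈cl : {X : Pred E p} → ⋆ ∈ cl X
    ⋆∈cl = cl-mono circuitSystem (λ ()) ⋆-loop

    -- A loop lies in every closure, so adding it enlarges none. This absorbs the image of a kernel,
    -- all of which is sent to `⋆`.
    cl-mono-⋆ : {X : Pred E ℓ} {Y : Pred E q} → Y ⊆ X ∪ ｛ ⋆ ｝ → cl Y ⊆ cl X
    cl-mono-⋆ {X = X} Y⊆ = cl-idem {X = X} λ y∈Y → case Y⊆ y∈Y of λ where
      (inj₁ y∈X)  → inj₁ y∈X
      (inj₂ refl) → ⋆∈cl

  -- Closure in a restriction

  module Restriction (M : PointedSystem ℓ) (S : Subset (PointedSystem.E M))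
                     (⋆∈S : PointedSystem.⋆ M ∈ ⟦ S ⟧) where
    open PointedSystem M
    private module R = PointedSystem (restriction M S ⋆∈S)

    restriction-cl⁻ : {X : Pred (Elem S) p} {x : Elem S} →
                      x ∈ R.cl X → proj₁ x ∈ cl (image proj₁ X)
    restriction-cl⁻ (inj₁ x∈X) = inj₁ (_ , x∈X , refl)
    restriction-cl⁻ {X = X} {x} (inj₂ (D , (C , C-circuit , C⊆S , D≗C) , x∈D , D⊆)) =
      inj₂ (C , C-circuit , subst T (D≗C x) x∈D , C⊆)
      where
      C⊆ : ⟦ C ⟧ ⊆ image proj₁ X ∪ ｛ proj₁ x ｝
      C⊆ {y} y∈C = case D⊆ {y , C⊆S y∈C} (subst T (sym (D≗C (y , C⊆S y∈C))) y∈C) of λ where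
        (inj₁ y∈X)  → inj₁ (_ , y∈X , refl)
        (inj₂ refl) → inj₂ refl

    restriction-cl⁺ : {X : Pred (Elem S) p} {x : Elem S} →
                      proj₁ x ∈ cl (image proj₁ X) → x ∈ R.cl X
    restriction-cl⁺ (inj₁ x∈X) = inj₁ (proj₁∈image⁻ x∈X)
    restriction-cl⁺ {X = X} {x} (inj₂ (C , C-circuit , x∈C , C⊆)) =
      inj₂ (C ∘ proj₁ , (C , C-circuit , C⊆S , λ _ → refl) , x∈C
           , λ y∈C → Sum.map proj₁∈image⁻ Elem-≡ (C⊆ y∈C))
      where
      C⊆S : ⟦ C ⟧ ⊆ ⟦ S ⟧
      C⊆S y∈C = case C⊆ y∈C of λ where
        (inj₁ (w , _ , refl)) → proj₂ w
        (inj₂ refl)           → proj₂ x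

    inclusion : StrongMap (restriction M S ⋆∈S) M
    inclusion = record
      { fun     = proj₁
      ; strong  = λ { A (x , x∈clA , refl) → restriction-cl⁻ x∈clA }
      ; pointed = refl
      }

  restriction• : (M : PointedMatroid ℓ) (S : Subset (PointedMatroid.E M)) →
                 PointedMatroid.⋆ M ∈ ⟦ S ⟧ → PointedMatroid ℓ
  restriction• M S ⋆∈S = record
    { pointedSystem = restriction pointedSystem S ⋆∈S
    ; isMatroid     = minor-isMatroid isMatroid _ proj₁ Elem-≡ (λ _ → false) ∅-independent (λ _ ())
        (cl-mono circuitSystem inj₁ ∘ restriction-cl⁻)
        (λ x∈cl → restriction-cl⁺ (cl-mono circuitSystem (λ { (inj₁ x∈X) → x∈X }) x∈cl))
        (λ { (C , C-circuit , C⊆S , ∅≗C) → ∅-independent C C-circuit λ {x} x∈C →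
               subst T (sym (∅≗C (x , C⊆S x∈C))) x∈C })
        (λ { D D′ (C , C-circuit , C⊆S , D≗C) (C′ , C′-circuit , _ , D′≗C′) D⊆D′ x →
               trans (D≗C x) (trans (CI C C′ C-circuit C′-circuit
                 (λ {y} y∈C → ≗⇒⊆ D′≗C′ {y , C⊆S y∈C} (D⊆D′ (≗⇒⊆ (sym ∘ D≗C) {y , C⊆S y∈C} y∈C)))
                 (proj₁ x)) (sym (D′≗C′ x))) })
    ; ⋆-loop        = restriction-cl⁺ ⋆∈cl
    }
    where
    open PointedMatroid M
    open IsMatroid isMatroid using (CI)
    open Pointed M using (∅-independent; ⋆∈cl)
    open Restriction pointedSystem S ⋆∈S

  -- Closure in a contraction

  module Contraction (M : PointedSystem ℓ) (S : Subset (PointedSystem.E M))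
                     (⋆∉S : PointedSystem.⋆ M ∈ ⟦ ∁ S ⟧) where
    open PointedSystem M
    private
      module K = PointedSystem (contraction M S ⋆∉S)
      c : E → Elem (∁ S)
      c = c⟨_⟩ M S ⋆∉S

    contraction-cl⁻ : {X : Pred (Elem (∁ S)) p} {x : Elem (∁ S)} →
                      x ∈ K.cl X → proj₁ x ∈ cl (image proj₁ X ∪ ⟦ S ⟧)
    contraction-cl⁻ (inj₁ x∈X) = inj₁ (inj₁ (_ , x∈X , refl))
    contraction-cl⁻ {X = X} {x} (inj₂ (D , ((C , C-circuit , D≗C) , _) , x∈D , D⊆)) =
      inj₂ (C , C-circuit , subst T (D≗C x) x∈D , C⊆)
      where
      C⊆ : ⟦ C ⟧ ⊆ (image proj₁ X ∪ ⟦ S ⟧) ∪ ｛ proj₁ x ｝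
      C⊆ {y} y∈C with T? (S y)
      ... | yes y∈S = inj₁ (inj₂ y∈S)
      ... | no  y∉S with D⊆ {y , ∉⇒∁ S y∉S} (subst T (sym (D≗C (y , ∉⇒∁ S y∉S))) y∈C)
      ...   | inj₁ y∈X  = inj₁ (inj₁ (_ , y∈X , refl))
      ...   | inj₂ refl = inj₂ refl

    c-cases : ∀ x → (Σ[ x∉S ∈ x ∈ ⟦ ∁ S ⟧ ] c x ≡ (x , x∉S)) ⊎ (x ∈ ⟦ S ⟧ × c x ≡ K.⋆)
    c-cases x with T? (∁ S x)
    ... | yes x∉S = inj₁ (x∉S , refl)
    ... | no ¬x∉S = inj₂ (decidable-stable (T? (S x)) (¬x∉S ∘ ∉⇒∁ S) , refl)

    c∘proj₁ : ∀ x → c (proj₁ x) ≡ x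
    c∘proj₁ x with c-cases (proj₁ x)
    ... | inj₁ (_ , eq)  = trans eq (Elem-≡ refl)
    ... | inj₂ (x∈S , _) = contradiction x∈S (∁⇒∉ S (proj₂ x))

  module ContractionMatroid (M : PointedMatroid ℓ) (S : Subset (PointedMatroid.E M))
                            (⋆∉S : PointedMatroid.⋆ M ∈ ⟦ ∁ S ⟧) where
    open PointedMatroid M
    open Pointed M
    open Circuits circuitSystem
    open Contraction pointedSystem S ⋆∉S
    private
      module K = PointedSystem (contraction pointedSystem S ⋆∉S)
      c : E → Elem (∁ S)
      c = c⟨_⟩ pointedSystem S ⋆∉S
      S-basis = basis (λ _ → false) S ∅-independent (λ ())
      B       = proj₁ S-basis
      B-ind   = proj₁ (proj₂ S-basis)
      B⊆S : ⟦ B ⟧ ⊆ ⟦ S ⟧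
      B⊆S     = proj₁ (proj₂ (proj₂ (proj₂ S-basis)))
      S⊆clB : ⟦ S ⟧ ⊆ cl ⟦ B ⟧
      S⊆clB   = proj₂ (proj₂ (proj₂ (proj₂ S-basis)))

    -- With B a basis of S and I a basis of B ∪ X containing B, the trace of the
    -- fundamental circuit of x with respect to I is a minimal trace.
    contraction-cl⁺ : {X : Pred (Elem (∁ S)) ℓ} {x : Elem (∁ S)} →
                      proj₁ x ∈ cl (image proj₁ X ∪ ⟦ S ⟧) → x ∈ K.cl X
    contraction-cl⁺ {X} {x} x∈cl with em {x ∈ X}
    ... | yes x∈X = inj₁ x∈X
    ... | no  x∉X = fundamental (cl-least I X∪S⊆clI x∈cl)
      where
      Y : Pred E ℓ
      Y = image proj₁ X ∪ ⟦ B ⟧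
      I-basis = basis B (subset Y) B-ind (∈-subset⁺ Y ∘ inj₂)
      I     = proj₁ I-basis
      I-ind = proj₁ (proj₂ I-basis)
      B⊆I : ⟦ B ⟧ ⊆ ⟦ I ⟧
      B⊆I   = proj₁ (proj₂ (proj₂ I-basis))
      I⊆Y : ⟦ I ⟧ ⊆ Y
      I⊆Y   = ∈-subset⁻ Y ∘ proj₁ (proj₂ (proj₂ (proj₂ I-basis)))
      Y⊆clI : Y ⊆ cl ⟦ I ⟧
      Y⊆clI = proj₂ (proj₂ (proj₂ (proj₂ I-basis))) ∘ ∈-subset⁺ Y

      X∪S⊆clI : image proj₁ X ∪ ⟦ S ⟧ ⊆ cl ⟦ I ⟧
      X∪S⊆clI (inj₁ y∈X) = Y⊆clI (inj₁ y∈X)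
      X∪S⊆clI (inj₂ y∈S) = cl-mono circuitSystem B⊆I (S⊆clB y∈S)

      I∩∁S⊆X : ∀ {y} → proj₁ y ∈ ⟦ I ⟧ → y ∈ X
      I∩∁S⊆X {y} y∈I with I⊆Y y∈I
      ... | inj₁ y∈X = proj₁∈image⁻ y∈X
      ... | inj₂ y∈B = contradiction (B⊆S y∈B) (∁⇒∉ S (proj₂ y))

      -- As `d` lies outside `S`, removing it from `I` leaves `B` intact, and `B` spans `S`.
      cl-∪S : {d : Elem (∁ S)} →
              cl (⟦ S ⟧ ∪ (⟦ I ⟧ ∖ ｛ proj₁ d ｝)) ⊆ cl (⟦ I ⟧ ∖ ｛ proj₁ d ｝)
      cl-∪S {d} = cl-idem {X = ⟦ I ⟧ ∖ ｛ proj₁ d ｝}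
        [ (λ s∈S → cl-mono circuitSystem
            (λ b∈B → B⊆I b∈B , λ { refl → ∁⇒∉ S (proj₂ d) (B⊆S b∈B) }) (S⊆clB s∈S))
        , inj₁ ]′

      module _ (C : Subset E) (C-circuit : Circuit C) (x∈C : proj₁ x ∈ ⟦ C ⟧)
               (C⊆ : ⟦ C ⟧ ⊆ ⟦ I ⟧ ∪ ｛ proj₁ x ｝) where

        C∖x⊆I : ⟦ C ⟧ ∖ ｛ proj₁ x ｝ ⊆ ⟦ I ⟧
        C∖x⊆I (y∈C , x≢y) with C⊆ y∈C
        ... | inj₁ y∈I = y∈I
        ... | inj₂ x≡y = contradiction x≡y x≢y

        -- If `x` were missing from `D`, then `D` would lie in `I`, and `C₁`, which is contained in
        -- `S` and `D`, would make `d` depend on the rest of `I`. So `x` is in `D`. If some `z` of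
        -- `C` off `S` were missing from `D`, then `C₁` would put `x` in the closure of `I` without
        -- `z`, and `C` would then put `z` itself there. Both contradict the independence of `I`.
        minimal : ∀ D → Trace pointedSystem S D → Satisfiable ⟦ D ⟧ →
                  ⟦ D ⟧ ⊆ ⟦ C ∘ proj₁ ⟧ → D ≗ C ∘ proj₁
        minimal D (C₁ , C₁-circuit , D≗C₁) (d , d∈D) D⊆C = ⊆-antisym {A = D} D⊆C C⊆D
          where
          D∌ : ∀ {y z} → y ∈ ⟦ D ⟧ → z ∉ ⟦ D ⟧ → proj₁ z ≢ proj₁ y
          D∌ y∈D z∉D eq = z∉D (subst (T ∘ D) (sym (Elem-≡ eq)) y∈D)

          C₁⊆ : ∀ {y} → y ∈ ⟦ C₁ ⟧ → y ∈ ⟦ S ⟧ ⊎ Σ[ y∉S ∈ y ∈ ⟦ ∁ S ⟧ ] (y , y∉S) ∈ ⟦ D ⟧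
          C₁⊆ {y} y∈C₁ with T? (S y)
          ... | yes y∈S = inj₁ y∈S
          ... | no  y∉S = inj₂ (∉⇒∁ S y∉S , subst T (sym (D≗C₁ _)) y∈C₁)

          x∈D : x ∈ ⟦ D ⟧
          x∈D = decidable-stable (T? (D x)) λ x∉D →
            independent⇒∉cl I-ind (C∖x⊆I (D⊆C d∈D , D∌ d∈D x∉D))
              (cl-∪S {d} (circuit⇒cl C₁-circuit (subst T (D≗C₁ d) d∈D)
                λ (y∈C₁ , d≢y) → Sum.map₂
                  (λ (y∉S , y∈D) → C∖x⊆I (D⊆C y∈D , D∌ y∈D x∉D) , d≢y)
                  (C₁⊆ y∈C₁)))

          C⊆D : ⟦ C ∘ proj₁ ⟧ ⊆ ⟦ D ⟧
          C⊆D {z} z∈C = decidable-stable (T? (D z)) λ z∉D →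
            let z∈I = C∖x⊆I (z∈C , D∌ x∈D z∉D ∘ sym)
                x∈cl : proj₁ x ∈ cl (⟦ I ⟧ ∖ ｛ proj₁ z ｝)
                x∈cl = cl-∪S {z} (circuit⇒cl C₁-circuit (subst T (D≗C₁ x) x∈D)
                  λ (y∈C₁ , x≢y) → Sum.map₂
                    (λ (y∉S , y∈D) → C∖x⊆I (D⊆C y∈D , x≢y) , D∌ y∈D z∉D)
                    (C₁⊆ y∈C₁))
            in independent⇒∉cl I-ind z∈I
                 (cl-idem {X = ⟦ I ⟧ ∖ ｛ proj₁ z ｝} {Y = (⟦ I ⟧ ∖ ｛ proj₁ z ｝) ∪ ｛ proj₁ x ｝}
                   [ inj₁ , (λ { refl → x∈cl }) ]′
                   (circuit⇒cl C-circuit z∈C λ (y∈C , z≢y) →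
                     Sum.map₁ (_, z≢y) (C⊆ y∈C)))

        minimalTrace : MinimalTrace pointedSystem S (C ∘ proj₁)
        minimalTrace = (C , C-circuit , λ _ → refl) , (x , x∈C) , minimal

      fundamental : proj₁ x ∈ cl ⟦ I ⟧ → x ∈ K.cl X
      fundamental (inj₁ x∈I) = inj₁ (I∩∁S⊆X x∈I)
      fundamental (inj₂ (C , C-circuit , x∈C , C⊆)) =
        inj₂ (C ∘ proj₁ , minimalTrace C C-circuit x∈C C⊆ , x∈C
             , λ y∈C → Sum.map I∩∁S⊆X Elem-≡ (C⊆ y∈C))

    contraction• : PointedMatroid ℓ
    contraction• = record
      { pointedSystem = contraction pointedSystem S ⋆∉S
      ; isMatroid     = minor-isMatroid isMatroid _ proj₁ Elem-≡ B B-ind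
          (λ x → ∁⇒∉ S (proj₂ x) ∘ B⊆S)
          -- The closure formula has `S` where `minor-isMatroid` expects the independent set `B`;
          -- the exchange is harmless because `B` is contained in `S` and spans it.
          (λ {X} x∈cl → cl-idem {X = image proj₁ X ∪ ⟦ B ⟧}
            [ inj₁ ∘ inj₁ , cl-mono circuitSystem inj₂ ∘ S⊆clB ]′
            (contraction-cl⁻ x∈cl))
          (contraction-cl⁺ ∘ cl-mono circuitSystem (Sum.map₂ B⊆S))
          (λ { (_ , (_ , ()) , _) })
          (λ { D D′ (D-trace , D-nonempty , _) (_ , _ , D′-minimal) D⊆D′ →
                 D′-minimal D D-trace D-nonempty D⊆D′ })
      ; ⋆-loop        = cl-mono (PointedSystem.circuitSystem (contraction pointedSystem S ⋆∉S))
          {X = λ _ → Lift ℓ ⊥} (λ { (lift ()) }) (contraction-cl⁺ ⋆∈cl)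
      }

    contractionMap : StrongMap pointedSystem (contraction pointedSystem S ⋆∉S)
    contractionMap = record
      { fun     = c
      ; strong  = λ { A (x , x∈clA , refl) → preserves A x∈clA }
      ; pointed = c∘proj₁ K.⋆
      }
      where
      c-image : (A : Pred E ℓ) → A ⊆ image proj₁ (image c A) ∪ ⟦ S ⟧
      c-image A {a} a∈A with c-cases a
      ... | inj₁ (_ , eq)  = inj₁ (c a , (a , a∈A , refl) , cong proj₁ eq)
      ... | inj₂ (a∈S , _) = inj₂ a∈S
      preserves : ∀ A {x} → x ∈ cl A → c x ∈ K.cl (image c A)
      preserves A {x} x∈clA with c-cases x
      ... | inj₁ (_ , eq) = cl-resp-≡ K.circuitSystem (sym eq)
        (contraction-cl⁺ (cl-mono circuitSystem (c-image A) x∈clA))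
      ... | inj₂ (_ , eq) = cl-resp-≡ K.circuitSystem (sym eq) (Pointed.⋆∈cl contraction•)

-- Embeddings and quotients among strong maps

module _ {ℓ : Level} {M N : PointedSystem ℓ} (f : StrongMap M N) where
  private
    module M = PointedSystem M
    module N = PointedSystem N

  strong⁺ : {A : Pred M.E ℓ} {x : M.E} → x ∈ M.cl A → fun f x ∈ N.cl (image (fun f) A)
  strong⁺ {A} x∈clA = strong f A (_ , x∈clA , refl)

  Kernel : Pred M.E ℓ
  Kernel x = fun f x ≡ N.⋆

  record IsEmbedding : Set (lsuc ℓ) where
    field
      injective : ∀ {x y} → fun f x ≡ fun f y → x ≡ y
      reflects  : ∀ {A : Pred M.E ℓ} {x} → fun f x ∈ N.cl (image (fun f) A) → x ∈ M.cl A

  record IsQuotient : Set (lsuc ℓ) where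
    field
      surjective    : ∀ y → ∃[ x ] fun f x ≡ y
      -- Membership of `y` in the kernel follows from that of `x` by the equation.
      injective-off : ∀ {x y} → fun f x ≡ fun f y → x ≡ y ⊎ x ∈ Kernel
      reflects      : ∀ {A : Pred M.E ℓ} {x} →
                      fun f x ∈ N.cl (image (fun f) A) → x ∈ M.cl (A ∪ Kernel)

module _ {ℓ : Level} where
  open Category (Sys• ℓ) using () renaming (_∙_ to _∙ₛ_)
  open PointedSystem using (E; ⋆; cl; circuitSystem)

  strongMap : {M N : PointedSystem ℓ} (f : E M → E N) →
              (∀ {A : Pred (E M) ℓ} {x} → x ∈ cl M A → f x ∈ cl N (image f A)) →
              f (⋆ M) ≡ ⋆ N → StrongMap M N
  strongMap f f-strong f-pointed = record
    { fun     = f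
    ; strong  = λ { A (_ , x∈clA , refl) → f-strong x∈clA }
    ; pointed = f-pointed
    }

  embedding-∙ : {M N P : PointedSystem ℓ} (f : StrongMap M N) (g : StrongMap N P) →
                IsEmbedding f → IsEmbedding g → IsEmbedding (g ∙ₛ f)
  embedding-∙ {P = P} f g f-emb g-emb = record
    { injective = F.injective ∘ G.injective
    ; reflects  = F.reflects ∘ G.reflects ∘ cl-mono (circuitSystem P)
        λ { (a , a∈A , refl) → _ , (a , a∈A , refl) , refl }
    }
    where
    module F = IsEmbedding f-emb
    module G = IsEmbedding g-emb

  -- The strong map `ψ` carries the closure relation back, and `ψ ∘ φ` fixes both `x` and `A`.
  retraction-reflects : {M N : PointedSystem ℓ} (φ : StrongMap M N) (ψ : StrongMap N M) →
                        fun ψ ∘ fun φ ≗ id → {A : Pred (E M) ℓ} {x : E M} →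
                        fun φ x ∈ cl N (image (fun φ) A) → x ∈ cl M A
  retraction-reflects {M} φ ψ ψφ {A} {x} x∈cl = cl-resp-≡ (circuitSystem M) (ψφ x)
    (cl-mono (circuitSystem M)
      (λ { (_ , (a , a∈A , refl) , refl) → subst A (sym (ψφ a)) a∈A })
      (strong⁺ ψ x∈cl))

  iso⇒embedding : {M N : PointedSystem ℓ} (f : StrongMap M N) →
                  IsIso (Sys• ℓ) f → IsEmbedding f
  iso⇒embedding f (g , gf , _) = record
    { injective = λ {x} {y} eq → trans (sym (gf x)) (trans (cong (fun g) eq) (gf y))
    ; reflects  = retraction-reflects f g gf
    }

  iso⇒quotient : {M N : PointedSystem ℓ} (f : StrongMap M N) →
                 IsIso (Sys• ℓ) f → IsQuotient f
  iso⇒quotient {M} f f-iso@(g , _ , fg) = record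
    { surjective    = λ y → fun g y , fg y
    ; injective-off = inj₁ ∘ injective
    ; reflects      = cl-mono (circuitSystem M) inj₁ ∘ reflects
    }
    where open IsEmbedding (iso⇒embedding f f-iso)

  embedding-resp-≗ : {M N : PointedSystem ℓ} {f g : StrongMap M N} →
                     fun f ≗ fun g → IsEmbedding f → IsEmbedding g
  embedding-resp-≗ {N = N} {g = g} f≗g f-emb = record
    { injective = λ {x} {y} eq → injective (trans (f≗g x) (trans eq (sym (f≗g y))))
    ; reflects  = λ {A} {x} x∈cl → reflects
        (cl-resp-≡ (circuitSystem N) (sym (f≗g x))
          (cl-mono (circuitSystem N) {X = image (fun g) A}
            (λ { (a , a∈A , refl) → a , a∈A , f≗g a }) x∈cl))
    }
    where open IsEmbedding f-emb

-- Admissible morphisms described by closure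

module Admissible {ℓ : Level} (em : ExcludedMiddle ℓ) where
  open PointedMatroid using (E; ⋆; cl; pointedSystem; circuitSystem)

  private
    Hom : PointedMatroid ℓ → PointedMatroid ℓ → Set (lsuc ℓ)
    Hom M N = StrongMap (pointedSystem M) (pointedSystem N)

  module _ {M N : PointedMatroid ℓ} where

    𝔐⇒embedding : (f : Hom M N) → 𝔐 ℓ M N f → IsEmbedding f
    𝔐⇒embedding f (S , ⋆∈S , φ , φ-iso , f≗) = embedding-resp-≗ {g = f} (sym ∘ f≗)
      (embedding-∙ φ inclusion (iso⇒embedding φ φ-iso) inclusion-embedding)
      where
      open Restriction em (pointedSystem N) S ⋆∈S
      inclusion-embedding : IsEmbedding inclusion
      inclusion-embedding = record { injective = Elem-≡ ; reflects = restriction-cl⁺ }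

    -- The restriction is to the image of `f`. Membership in `S` yields a preimage, injectivity
    -- makes this choice inverse to `φ`, and reflection of closure makes the inverse strong.
    embedding⇒𝔐 : (f : Hom M N) → IsEmbedding f → 𝔐 ℓ M N f
    embedding⇒𝔐 f f-emb = S , ⋆∈S , φ , (ψ , ψφ , φψ) , λ _ → refl
      where
      open IsEmbedding f-emb
      P : Pred (E N) ℓ
      P y = ∃[ x ] fun f x ≡ y
      S = subset em P
      ⋆∈S = ∈-subset⁺ em P (⋆ M , pointed f)
      open Restriction em (pointedSystem N) S ⋆∈S
      φ-fun : E M → Elem S
      φ-fun x = fun f x , ∈-subset⁺ em P (x , refl)
      φ = strongMap φ-fun
        (λ x∈clA → restriction-cl⁺ (cl-mono (circuitSystem N)
          (λ { (a , a∈A , refl) → φ-fun a , (a , a∈A , refl) , refl }) (strong⁺ f x∈clA)))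
        (Elem-≡ (pointed f))
      preimage : (y : Elem S) → ∃[ x ] fun f x ≡ proj₁ y
      preimage (y , y∈S) = ∈-subset⁻ em P y∈S
      ψ-fun : Elem S → E M
      ψ-fun = proj₁ ∘ preimage
      φψ : φ-fun ∘ ψ-fun ≗ id
      φψ y = Elem-≡ (proj₂ (preimage y))
      ψφ : ψ-fun ∘ φ-fun ≗ id
      ψφ x = injective (proj₂ (preimage (φ-fun x)))
      ψ = strongMap ψ-fun
        (λ {A} {x} x∈clA → reflects (cl-resp-≡ (circuitSystem N) (sym (proj₂ (preimage x)))
          (cl-mono (circuitSystem N)
            {Y = image (fun f) (image ψ-fun A)}
            (λ { (a , a∈A , refl) → ψ-fun a , (a , a∈A , refl) , proj₂ (preimage a) })
            (restriction-cl⁻ x∈clA))))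
        (injective (trans (proj₂ (preimage (⋆ N , ⋆∈S))) (sym (pointed f))))

    𝔈⇒quotient : (f : Hom M N) → 𝔈 ℓ M N f → IsQuotient f
    𝔈⇒quotient f (S , ⋆∉S , φ , (ψ , ψφ , φψ) , f≗) = record
      { surjective    = λ y → proj₁ (fun ψ y) , trans (f≗ _)
          (trans (cong (fun φ) (c∘proj₁ (fun ψ y))) (φψ y))
      ; injective-off = λ {x} {y} eq → c-injective-off
          (trans (sym (ψφ (c x)))
            (trans (cong (fun ψ) (trans (sym (f≗ x)) (trans eq (f≗ y)))) (ψφ (c y))))
      ; reflects      = λ {A} {x} → f-reflects A x
      }
      where
      open Contraction em (pointedSystem M) S ⋆∉S
      c = c⟨_⟩ (pointedSystem M) S ⋆∉S
      K = contraction (pointedSystem M) S ⋆∉S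
      c≡⋆⇒kernel : ∀ {x} → c x ≡ PointedSystem.⋆ K → x ∈ Kernel f
      c≡⋆⇒kernel eq = trans (f≗ _) (trans (cong (fun φ) eq) (pointed φ))
      c-injective-off : ∀ {x y} → c x ≡ c y → x ≡ y ⊎ x ∈ Kernel f
      c-injective-off {x} {y} eq with c-cases x | c-cases y
      ... | inj₂ (_ , cx≡⋆) | _               = inj₂ (c≡⋆⇒kernel cx≡⋆)
      ... | inj₁ _          | inj₂ (_ , cy≡⋆) = inj₂ (c≡⋆⇒kernel (trans eq cy≡⋆))
      ... | inj₁ (_ , cx≡x) | inj₁ (_ , cy≡y) = inj₁ (cong proj₁ (trans (sym cx≡x) (trans eq cy≡y)))
      -- The closure formula for the contraction adds `S` to the spanning set. All of `S` lies in
      -- the kernel of `f`, and so does the point to which `c` moves the elements of `A` inside `S`.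
      f-reflects : ∀ A x → fun f x ∈ cl N (image (fun f) A) → x ∈ cl M (A ∪ Kernel f)
      f-reflects A x fx∈cl with c-cases x
      ... | inj₂ (_ , cx≡⋆) = inj₁ (inj₂ (c≡⋆⇒kernel cx≡⋆))
      ... | inj₁ (x∉S , cx≡x) = cl-mono (circuitSystem M) lifts (contraction-cl⁻
        (cl-resp-≡ (PointedSystem.circuitSystem K) cx≡x (retraction-reflects φ ψ ψφ
          (cl-resp-≡ (circuitSystem N) (f≗ x)
            (cl-mono (circuitSystem N) {Y = image (fun φ) (image c A)}
            (λ { (a , a∈A , refl) → c a , (a , a∈A , refl) , sym (f≗ a) }) fx∈cl)))))
        where
        lifts : image proj₁ (image c A) ∪ ⟦ S ⟧ ⊆ A ∪ Kernel f
        lifts (inj₁ (_ , (a , a∈A , refl) , refl)) with c-cases a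
        ... | inj₁ (_ , ca≡a) = inj₁ (subst A (sym (cong proj₁ ca≡a)) a∈A)
        ... | inj₂ (_ , ca≡⋆) = inj₂ (subst (Kernel f) (sym (cong proj₁ ca≡⋆)) (pointed f))
        lifts {s} (inj₂ s∈S) with c-cases s
        ... | inj₁ (s∉S , _)  = contradiction s∈S (∁⇒∉ S s∉S)
        ... | inj₂ (_ , cs≡⋆) = inj₂ (c≡⋆⇒kernel cs≡⋆)

    quotient⇒𝔈 : (f : Hom M N) → IsQuotient f → 𝔈 ℓ M N f
    quotient⇒𝔈 f f-quo = S , ⋆∉S , φ , (ψ , ψφ , φψ) , λ x → sym (f∘c x)
      where
      open IsQuotient f-quo
      -- A pointed contraction has to keep `⋆`, so the kernel is contracted except for `⋆`. Being a
      -- loop, `⋆` makes no difference to closures.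
      P : Pred (E M) ℓ
      P x = x ∈ Kernel f × x ≢ ⋆ M
      S = subset em P
      ⋆∉S : ⋆ M ∈ ⟦ ∁ S ⟧
      ⋆∉S = ∉⇒∁ S λ ⋆∈S → proj₂ (∈-subset⁻ em P ⋆∈S) refl
      open Contraction em (pointedSystem M) S ⋆∉S
      open ContractionMatroid em M S ⋆∉S
      c = c⟨_⟩ (pointedSystem M) S ⋆∉S
      φ-fun : Elem (∁ S) → E N
      φ-fun = fun f ∘ proj₁
      kernel⊆S∪⋆ : Kernel f ⊆ ⟦ S ⟧ ∪ ｛ ⋆ M ｝
      kernel⊆S∪⋆ {x} fx≡⋆ with em {⋆ M ≡ x}
      ... | yes ⋆≡x = inj₂ ⋆≡x
      ... | no  ⋆≢x = inj₁ (∈-subset⁺ em P (fx≡⋆ , ⋆≢x ∘ sym))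
      f∘c : ∀ x → φ-fun (c x) ≡ fun f x
      f∘c x with c-cases x
      ... | inj₁ (_ , cx≡x)   = cong φ-fun cx≡x
      ... | inj₂ (x∈S , cx≡⋆) = trans (cong φ-fun cx≡⋆)
        (trans (pointed f) (sym (proj₁ (∈-subset⁻ em P x∈S))))
      -- The only kernel element that survives outside `S` is `⋆`, so the second alternative of
      -- `injective-off` also gives equality.
      φ-injective : ∀ {x y} → φ-fun x ≡ φ-fun y → x ≡ y
      φ-injective {x} {y} eq with injective-off eq
      ... | inj₁ x≡y = Elem-≡ x≡y
      ... | inj₂ x∈Ker = Elem-≡ (trans (sym (⋆≡ x x∈Ker)) (⋆≡ y (trans (sym eq) x∈Ker)))
        where
        ⋆≡ : ∀ z → proj₁ z ∈ Kernel f → ⋆ M ≡ proj₁ z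
        ⋆≡ z z∈Ker = case kernel⊆S∪⋆ z∈Ker of λ where
          (inj₁ z∈S) → contradiction z∈S (∁⇒∉ S (proj₂ z))
          (inj₂ ⋆≡z) → ⋆≡z
      φ = strongMap φ-fun
        (λ {A} x∈clA → Pointed.cl-mono-⋆ em N
          (λ { (_ , inj₁ (a , a∈A , refl) , refl) → inj₁ (a , a∈A , refl)
             ; (_ , inj₂ s∈S , refl) → inj₂ (sym (proj₁ (∈-subset⁻ em P s∈S))) })
          (strong⁺ f (contraction-cl⁻ x∈clA)))
        (pointed f)
      ψ-fun : E N → Elem (∁ S)
      ψ-fun y = c (proj₁ (surjective y))
      φψ : φ-fun ∘ ψ-fun ≗ id
      φψ y = trans (f∘c _) (proj₂ (surjective y))
      ψφ : ψ-fun ∘ φ-fun ≗ id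
      ψφ x = φ-injective (φψ (φ-fun x))
      ψ = strongMap ψ-fun
        (λ {A} {x} x∈clA → contraction-cl⁺
          (Pointed.cl-mono-⋆ em M {X = image proj₁ (image ψ-fun A) ∪ ⟦ S ⟧}
            [ inj₁ ∘ inj₁ , Sum.map₁ inj₂ ∘ kernel⊆S∪⋆ ]′
            (reflects (cl-resp-≡ (circuitSystem N) (sym (φψ x)) (cl-mono (circuitSystem N)
              (λ {a} a∈A → _ , (_ , (a , a∈A , refl) , refl) , φψ a) x∈clA)))))
        (φ-injective (trans (φψ (⋆ N)) (sym (pointed f))))

  quotient-∙ : {M N P : PointedMatroid ℓ} (f : Hom M N) (g : Hom N P) →
               IsQuotient f → IsQuotient g → IsQuotient (Category._∙_ (Sys• ℓ) g f)
  quotient-∙ {M} {N} {P} f g f-quo g-quo = record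
    { surjective    = λ z → let y , gy≡z = G.surjective z
                                x , fx≡y = F.surjective y
                            in x , trans (cong (fun g) fx≡y) gy≡z
    ; injective-off = λ eq → case G.injective-off eq of λ where
        (inj₁ fx≡fy) → Sum.map₂ kernel-∙ (F.injective-off fx≡fy)
        (inj₂ gfx≡⋆) → inj₂ gfx≡⋆
    ; reflects      = λ {A} x∈cl → cl-mono (circuitSystem M)
        [ id , inj₂ ∘ kernel-∙ ]′
        (F.reflects (cl-mono (circuitSystem N) (preimages A)
          (G.reflects (cl-mono (circuitSystem P)
            (λ { (a , a∈A , refl) → _ , (a , a∈A , refl) , refl }) x∈cl))))
    }
    where
    module F = IsQuotient f-quo
    module G = IsQuotient g-quo
    g∙f : Hom M P
    g∙f = Category._∙_ (Sys• ℓ) g f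
    kernel-∙ : Kernel f ⊆ Kernel g∙f
    kernel-∙ fx≡⋆ = trans (cong (fun g) fx≡⋆) (pointed g)
    -- Surjectivity of `f` lifts the kernel of `g` to elements of `M`, and these lie in the kernel
    -- of the composite.
    preimages : ∀ A → image (fun f) A ∪ Kernel g ⊆ image (fun f) (A ∪ Kernel g∙f)
    preimages A (inj₁ (a , a∈A , eq)) = a , inj₁ a∈A , eq
    preimages A {y} (inj₂ gy≡⋆) =
      let x , fx≡y = F.surjective y in x , inj₂ (trans (cong (fun g) fx≡y) gy≡⋆) , fx≡y

  -- Squares of admissible morphisms

  module _ {M N M′ N′ : PointedMatroid ℓ}
           (i : Hom M N) (j : Hom M M′) (j′ : Hom N N′) (i′ : Hom M′ N′)
           (i-emb : IsEmbedding i) (i′-emb : IsEmbedding i′)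
           (j-quo : IsQuotient j) (j′-quo : IsQuotient j′)
           (comm : Commutes (Mat• ℓ) {M} {N} {M′} {N′} i j j′ i′) where
    private
      module I  = IsEmbedding i-emb
      module I′ = IsEmbedding i′-emb
      module J  = IsQuotient j-quo
      module J′ = IsQuotient j′-quo

    KernelInImage : Set ℓ
    KernelInImage = ∀ x → x ∈ Kernel j′ → ∃[ m ] fun i m ≡ x

    -- To factor `p` through `i`, take `m` with `j m` equal to `q x`. Then `i m` and `p x` agree
    -- under `j′`, so they are equal or both lie in the kernel of `j′`; in the latter case the
    -- hypothesis supplies a preimage of `p x`. Strength of the factor comes from reflection of
    -- closure along `i`.
    kernelInImage⇒cartesian : KernelInImage → IsCartesian (Mat• ℓ) {M} {N} {M′} {N′} i j j′ i′
    kernelInImage⇒cartesian ker⊆im = comm , λ {Q} p q j′p≗i′q →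
      let lift-p : ∀ x → ∃[ m ] fun i m ≡ fun p x
          lift-p x =
            let m , jm≡qx = J.surjective (fun q x)
                j′im≡j′px = trans (comm m) (trans (cong (fun i′) jm≡qx) (sym (j′p≗i′q x)))
            in case J′.injective-off j′im≡j′px of λ where
                 (inj₁ im≡px)  → m , im≡px
                 (inj₂ j′im≡⋆) → ker⊆im (fun p x)
                   (trans (sym j′im≡j′px) j′im≡⋆)
          u-fun = proj₁ ∘ lift-p
          i∘u = proj₂ ∘ lift-p
          u : Hom Q M
          u = strongMap u-fun
            (λ {A} {x} x∈clA → I.reflects (cl-resp-≡ (circuitSystem N) (sym (i∘u x))
              (cl-mono (circuitSystem N) {Y = image (fun i) (image u-fun A)}
                (λ { (a , a∈A , refl) → u-fun a , (a , a∈A , refl) , i∘u a }) (strong⁺ p x∈clA))))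
            (I.injective (trans (i∘u (⋆ Q)) (trans (pointed p) (sym (pointed i)))))
      in u , i∘u
         , (λ x → I′.injective (trans (sym (comm (u-fun x)))
             (trans (cong (fun j′) (i∘u x)) (j′p≗i′q x))))
         , λ v i∘v _ x → I.injective (trans (i∘v x) (sym (i∘u x)))

    -- The map `p` kills the kernel of `j′`: such an element is some `i m`, injectivity of `i′`
    -- gives that `j m` is the point, and `p ∘ i` agrees with `q ∘ j`. So `p` is constant on the
    -- fibres of `j′`. The induced map is strong because `j′` reflects closure up to its kernel,
    -- which `p` sends to a loop.
    kernelInImage⇒coCartesian : KernelInImage → IsCoCartesian (Mat• ℓ) {M} {N} {M′} {N′} i j j′ i′
    kernelInImage⇒coCartesian ker⊆im = comm , λ {Q} p q pi≗qj →
      let p-kernel : ∀ {x} → x ∈ Kernel j′ → fun p x ≡ ⋆ Q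
          p-kernel {x} j′x≡⋆ =
            let m , im≡x = ker⊆im x j′x≡⋆
                jm≡⋆ = I′.injective (trans (sym (comm m))
                         (trans (cong (fun j′) im≡x) (trans j′x≡⋆ (sym (pointed i′)))))
            in trans (cong (fun p) (sym im≡x))
                 (trans (pi≗qj m) (trans (cong (fun q) jm≡⋆) (pointed q)))
          p-factors : ∀ {x y} → fun j′ x ≡ fun j′ y → fun p x ≡ fun p y
          p-factors eq = case J′.injective-off eq of λ where
            (inj₁ x≡y)   → cong (fun p) x≡y
            (inj₂ j′x≡⋆) → trans (p-kernel j′x≡⋆) (sym (p-kernel (trans (sym eq) j′x≡⋆)))
          section = proj₁ ∘ J′.surjective
          j′∘section = proj₂ ∘ J′.surjective
          u-fun = fun p ∘ section
          u∘j′ : u-fun ∘ fun j′ ≗ fun p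
          u∘j′ x = p-factors (j′∘section (fun j′ x))
          u : Hom N′ Q
          u = strongMap u-fun
            (λ {A} {y} y∈clA → Pointed.cl-mono-⋆ em Q
              (λ { (_ , inj₁ (a , a∈A , refl) , refl) → inj₁ (a , a∈A , refl)
                 ; (_ , inj₂ j′x≡⋆ , refl)            → inj₂ (sym (p-kernel j′x≡⋆)) })
              (strong⁺ p (J′.reflects {A = image section A}
                (cl-resp-≡ (circuitSystem N′) (sym (j′∘section y))
                  (cl-mono (circuitSystem N′)
                    (λ {a} a∈A → section a , (a , a∈A , refl) , j′∘section a) y∈clA)))))
            (p-kernel (j′∘section (⋆ N′)))
      in u , u∘j′
         , (λ y → let m , jm≡y = J.surjective y in
              trans (cong (u-fun ∘ fun i′) (sym jm≡y))
                (trans (cong u-fun (sym (comm m)))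
                  (trans (u∘j′ (fun i m)) (trans (pi≗qj m) (cong (fun q) jm≡y)))))
         , λ v v∘j′ _ y → trans (cong (fun v) (sym (j′∘section y))) (v∘j′ (section y))

    -- Test the pullback on N | ker j′.
    cartesian⇒kernelInImage : IsCartesian (Mat• ℓ) {M} {N} {M′} {N′} i j j′ i′ → KernelInImage
    cartesian⇒kernelInImage (_ , universal) x x∈Ker =
      let u , i∘u , _ = universal {restriction• em N S ⋆∈S} inclusion zero
            (λ y → trans (∈-subset⁻ em (Kernel j′) (proj₂ y)) (sym (pointed i′)))
          y = x , ∈-subset⁺ em (Kernel j′) x∈Ker
      in fun u y , i∘u y
      where
      S = subset em (Kernel j′)
      ⋆∈S = ∈-subset⁺ em (Kernel j′) (pointed j′)
      open Restriction em (pointedSystem N) S ⋆∈S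
      zero : StrongMap (restriction (pointedSystem N) S ⋆∈S) (pointedSystem M′)
      zero = strongMap (const (⋆ M′)) (λ _ → Pointed.⋆∈cl em M′) refl

    -- Test the pushout on the characteristic function of the image of i, as a
    -- map to the matroid of two loops.
    coCartesian⇒kernelInImage : IsCoCartesian (Mat• ℓ) {M} {N} {M′} {N′} i j j′ i′ → KernelInImage
    coCartesian⇒kernelInImage (_ , universal) x x∈Ker =
      let u , u∘j′ , _ = universal {Q} χ zero
            (λ m → cong lift (Equivalence.to T-≡ (∈-subset⁺ em Im (m , refl))))
          χx≡true : χ-fun x ≡ lift true
          χx≡true = trans (sym (u∘j′ x)) (trans (cong (fun u) x∈Ker) (pointed u))
      in ∈-subset⁻ em Im (Equivalence.from T-≡ (cong lower χx≡true))
      where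
      Im : Pred (E N) ℓ
      Im y = ∃[ m ] fun i m ≡ y
      -- The point has to be `true`: the image of the pointed map `i` contains `⋆ N`.
      Q = loops• em (Lift ℓ Bool) (lift true)
      χ-fun : E N → Lift ℓ Bool
      χ-fun y = lift (subset em Im y)
      χ : Hom N Q
      χ = strongMap χ-fun (λ _ → loops-cl em _)
        (cong lift (Equivalence.to T-≡ (∈-subset⁺ em Im (⋆ M , pointed i))))
      zero : Hom M′ Q
      zero = strongMap (const (lift true)) (λ _ → loops-cl em _) refl

    kernelInImage⇒biCartesian : KernelInImage → IsBiCartesian (Mat• ℓ) {M} {N} {M′} {N′} i j j′ i′
    kernelInImage⇒biCartesian ker⊆im =
      kernelInImage⇒cartesian ker⊆im , kernelInImage⇒coCartesian ker⊆im

    cartesian⇔coCartesian : IsCartesian (Mat• ℓ) {M} {N} {M′} {N′} i j j′ i′ ⇔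
                            IsCoCartesian (Mat• ℓ) {M} {N} {M′} {N′} i j j′ i′
    cartesian⇔coCartesian = mk⇔
      (kernelInImage⇒coCartesian ∘ cartesian⇒kernelInImage)
      (kernelInImage⇒cartesian ∘ coCartesian⇒kernelInImage)

  -- Completing cospans and spans

  module _ {N M′ N′ : PointedMatroid ℓ} (j′ : Hom N N′) (i′ : Hom M′ N′)
           (i′-emb : IsEmbedding i′) (j′-quo : IsQuotient j′) where
    private
      module I′ = IsEmbedding i′-emb
      module J′ = IsQuotient j′-quo

    -- The corner is `N` restricted to the preimage under `j′` of the image of `i′`. That image
    -- contains the point, so the preimage contains the kernel of `j′`, which is the criterion for a
    -- bi-Cartesian square. The properties of `j` are those of `j′`, transferred along the embedding
    -- `i′`.
    completeCospan :
      Σ[ M ∈ PointedMatroid ℓ ] Σ[ i ∈ Hom M N ] Σ[ j ∈ Hom M M′ ]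
        (𝔐 ℓ M N i × 𝔈 ℓ M M′ j × IsBiCartesian (Mat• ℓ) {M} {N} {M′} {N′} i j j′ i′)
    completeCospan = M , inclusion , j
      , embedding⇒𝔐 {M} {N} inclusion i-emb , quotient⇒𝔈 {M} {M′} j j-quo
      , kernelInImage⇒biCartesian {M} {N} {M′} {N′} inclusion j j′ i′
          i-emb i′-emb j-quo j′-quo (sym ∘ i′∘j)
          (λ x j′x≡⋆ → (x , kernel⊆S j′x≡⋆) , refl)
      where
      P : Pred (E N) ℓ
      P x = ∃[ m ] fun i′ m ≡ fun j′ x
      S = subset em P
      kernel⊆S : Kernel j′ ⊆ ⟦ S ⟧
      kernel⊆S j′x≡⋆ = ∈-subset⁺ em P (⋆ M′ , trans (pointed i′) (sym j′x≡⋆))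
      ⋆∈S : ⋆ N ∈ ⟦ S ⟧
      ⋆∈S = kernel⊆S (pointed j′)
      open Restriction em (pointedSystem N) S ⋆∈S
      M = restriction• em N S ⋆∈S
      i-emb : IsEmbedding inclusion
      i-emb = record { injective = Elem-≡ ; reflects = restriction-cl⁺ }
      lift-j′ : (x : Elem S) → ∃[ m ] fun i′ m ≡ fun j′ (proj₁ x)
      lift-j′ (x , x∈S) = ∈-subset⁻ em P x∈S
      j-fun = proj₁ ∘ lift-j′
      i′∘j : ∀ x → fun i′ (j-fun x) ≡ fun j′ (proj₁ x)
      i′∘j = proj₂ ∘ lift-j′
      j : Hom M M′
      j = strongMap j-fun
        (λ {A} {x} x∈clA → I′.reflects (cl-resp-≡ (circuitSystem N′) (sym (i′∘j x))
          (cl-mono (circuitSystem N′) {Y = image (fun i′) (image j-fun A)}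
            (λ { (_ , (a , a∈A , refl) , refl) → j-fun a , (a , a∈A , refl) , i′∘j a })
            (strong⁺ j′ (restriction-cl⁻ x∈clA)))))
        (I′.injective (trans (i′∘j (⋆ M)) (trans (pointed j′) (sym (pointed i′)))))
      kernel-j : ∀ {x} → proj₁ x ∈ Kernel j′ → x ∈ Kernel j
      kernel-j {x} j′x≡⋆ = I′.injective (trans (i′∘j x) (trans j′x≡⋆ (sym (pointed i′))))
      j-quo : IsQuotient j
      j-quo = record
        { surjective    = λ m → let x , j′x≡i′m = J′.surjective (fun i′ m)
                                    x∈S = ∈-subset⁺ em P (m , sym j′x≡i′m)
                                in (x , x∈S) , I′.injective (trans (i′∘j (x , x∈S)) j′x≡i′m)
        ; injective-off = λ {x} {y} eq → Sum.map Elem-≡ kernel-j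
            (J′.injective-off (trans (sym (i′∘j x)) (trans (cong (fun i′) eq) (i′∘j y))))
        ; reflects      = λ {A} {x} x∈cl → restriction-cl⁺ (cl-mono (circuitSystem N)
            {Y = image proj₁ (A ∪ Kernel j)}
            (λ { (inj₁ (a , a∈A , refl)) → a , inj₁ a∈A , refl
               ; {y} (inj₂ j′y≡⋆) → (y , kernel⊆S j′y≡⋆) , inj₂ (kernel-j j′y≡⋆) , refl })
            (J′.reflects {A = image proj₁ A} (cl-resp-≡ (circuitSystem N′) (i′∘j x)
              (cl-mono (circuitSystem N′)
                (λ { (_ , (a , a∈A , refl) , refl) → proj₁ a , (a , a∈A , refl) , sym (i′∘j a) })
                (strong⁺ i′ x∈cl)))))
        }

  module _ {M N M′ : PointedMatroid ℓ} (i : Hom M N) (j : Hom M M′)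
           (i-emb : IsEmbedding i) (j-quo : IsQuotient j) where
    private
      module I = IsEmbedding i-emb
      module J = IsQuotient j-quo

    -- The corner is `N` contracted by the image under `i` of the kernel of `j`, again without `⋆`.
    -- The kernel of `j′` is then exactly that image, which gives the criterion.
    completeSpan :
      Σ[ N′ ∈ PointedMatroid ℓ ] Σ[ j′ ∈ Hom N N′ ] Σ[ i′ ∈ Hom M′ N′ ]
        (𝔐 ℓ M′ N′ i′ × 𝔈 ℓ N N′ j′ × IsBiCartesian (Mat• ℓ) {M} {N} {M′} {N′} i j j′ i′)
    completeSpan = N′ , j′ , i′ , embedding⇒𝔐 {M′} {N′} i′ i′-emb , j′∈𝔈
      , kernelInImage⇒biCartesian {M} {N} {M′} {N′} i j j′ i′ i-emb i′-emb j-quo j′-quo (sym ∘ i′∘j)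
          (λ x j′x≡⋆ → map₂ proj₂ (kernel-j′ j′x≡⋆))
      where
      P : Pred (E N) ℓ
      P x = (∃[ m ] (m ∈ Kernel j × fun i m ≡ x)) × x ≢ ⋆ N
      S = subset em P
      ⋆∉S : ⋆ N ∈ ⟦ ∁ S ⟧
      ⋆∉S = ∉⇒∁ S λ ⋆∈S → proj₂ (∈-subset⁻ em P ⋆∈S) refl
      open Contraction em (pointedSystem N) S ⋆∉S
      open ContractionMatroid em N S ⋆∉S
      N′ = contraction•
      j′ : Hom N N′
      j′ = contractionMap
      j′∈𝔈 : 𝔈 ℓ N N′ j′
      j′∈𝔈 = S , ⋆∉S , Category.idm (Sys• ℓ)
        , (Category.idm (Sys• ℓ) , (λ _ → refl) , λ _ → refl) , λ _ → refl
      j′-quo : IsQuotient j′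
      j′-quo = 𝔈⇒quotient {N} {N′} j′ j′∈𝔈

      kernel-j′ : ∀ {x} → x ∈ Kernel j′ → ∃[ m ] (m ∈ Kernel j × fun i m ≡ x)
      kernel-j′ {x} j′x≡⋆ with c-cases x
      ... | inj₁ (_ , j′x≡x) = ⋆ M , pointed j
        , trans (pointed i) (cong proj₁ (trans (sym j′x≡⋆) j′x≡x))
      ... | inj₂ (x∈S , _)   = proj₁ (∈-subset⁻ em P x∈S)
      kernel-j : ∀ {m} → m ∈ Kernel j → fun i m ∈ Kernel j′
      kernel-j {m} jm≡⋆ with c-cases (fun i m)
      ... | inj₂ (_ , j′im≡⋆)    = j′im≡⋆
      ... | inj₁ (im∉S , j′im≡im) = trans j′im≡im (Elem-≡ (by-contradiction em λ im≢⋆ →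
        ∁⇒∉ S im∉S (∈-subset⁺ em P ((m , jm≡⋆ , refl) , im≢⋆))))
      kernel-j⁻ : ∀ {m} → fun i m ∈ Kernel j′ → m ∈ Kernel j
      kernel-j⁻ j′im≡⋆ = let n , jn≡⋆ , in≡im = kernel-j′ j′im≡⋆
                         in subst (Kernel j) (I.injective in≡im) jn≡⋆

      section = proj₁ ∘ J.surjective
      j∘section = proj₂ ∘ J.surjective
      -- The choice of preimages under `j` is immaterial: `j` identifies distinct elements only
      -- inside its kernel, and `j′ ∘ i` sends that kernel to the point.
      i′-fun : E M′ → E N′
      i′-fun = fun j′ ∘ fun i ∘ section
      i′∘j : ∀ m → i′-fun (fun j m) ≡ fun j′ (fun i m)
      i′∘j m with J.injective-off (j∘section (fun j m))
      ... | inj₁ eq   = cong (fun j′ ∘ fun i) eq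
      ... | inj₂ jn≡⋆ = trans (kernel-j jn≡⋆)
        (sym (kernel-j (trans (sym (j∘section (fun j m))) jn≡⋆)))

      i′ : Hom M′ N′
      i′ = strongMap i′-fun
        (λ {A} {y} y∈clA → Pointed.cl-mono-⋆ em N′
          (λ { (_ , (_ , inj₁ (a , a∈A , refl) , refl) , refl) → inj₁ (a , a∈A , refl)
             ; (_ , (_ , inj₂ jm≡⋆ , refl) , refl)             → inj₂ (sym (kernel-j jm≡⋆)) })
          (strong⁺ j′ (strong⁺ i (J.reflects {A = image section A}
            (cl-resp-≡ (circuitSystem M′) (sym (j∘section y)) (cl-mono (circuitSystem M′)
              (λ {a} a∈A → section a , (a , a∈A , refl) , j∘section a) y∈clA))))))
        (trans (cong i′-fun (sym (pointed j)))
          (trans (i′∘j (⋆ M)) (trans (cong (fun j′) (pointed i)) (pointed j′))))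
      i′-emb : IsEmbedding i′
      i′-emb = record { injective = i′-injective ; reflects = i′-reflects }
        where
        module J′ = IsQuotient j′-quo
        i′-injective : ∀ {x y} → i′-fun x ≡ i′-fun y → x ≡ y
        i′-injective {x} {y} eq with J′.injective-off eq
        ... | inj₁ ix≡iy = trans (sym (j∘section x))
          (trans (cong (fun j) (I.injective ix≡iy)) (j∘section y))
        ... | inj₂ i′x≡⋆ = trans (⋆≡ i′x≡⋆) (sym (⋆≡ (trans (sym eq) i′x≡⋆)))
          where
          ⋆≡ : ∀ {z} → i′-fun z ≡ ⋆ N′ → z ≡ ⋆ M′
          ⋆≡ {z} i′z≡⋆ = trans (sym (j∘section z)) (kernel-j⁻ i′z≡⋆)
        -- Reflection along `j′` adds the kernel of `j′`, which is the image of the kernel of `j`.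
        -- After reflection along `i` the relation holds in `M` up to the kernel of `j`, and
        -- applying `j` turns that kernel into the loop `⋆`.
        i′-reflects : ∀ {A : Pred (E M′) ℓ} {y} → i′-fun y ∈ cl N′ (image i′-fun A) → y ∈ cl M′ A
        i′-reflects {A} {y} y∈cl = cl-resp-≡ (circuitSystem M′) (j∘section y)
          (Pointed.cl-mono-⋆ em M′
            (λ { (_ , inj₁ (a , a∈A , refl) , refl) → inj₁ (subst A (sym (j∘section a)) a∈A)
               ; (_ , inj₂ jm≡⋆ , refl)             → inj₂ (sym jm≡⋆) })
            (strong⁺ j (I.reflects {A = image section A ∪ Kernel j} (cl-mono (circuitSystem N)
              (λ { (inj₁ (_ , (a , a∈A , refl) , refl)) → section a , inj₁ (a , a∈A , refl) , refl
                 ; (inj₂ j′x≡⋆) → let m , jm≡⋆ , im≡x = kernel-j′ j′x≡⋆ in m , inj₂ jm≡⋆ , im≡x })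
              (J′.reflects {A = image (fun i) (image section A)}
                (cl-mono (circuitSystem N′)
                  (λ { (a , a∈A , refl) → _ , (_ , (a , a∈A , refl) , refl) , refl }) y∈cl))))))

  -- The zero object and the axioms

  𝟎 : PointedMatroid ℓ
  𝟎 = loops• em ⊤ tt

  𝟎-isZero : IsZero (Mat• ℓ) 𝟎
  𝟎-isZero =
      (λ A → strongMap (const (⋆ A)) (λ _ → Pointed.⋆∈cl em A) refl , λ g _ → pointed g)
    , (λ A → strongMap (const tt) (λ _ → loops-cl em ⊤) refl , λ _ _ → refl)

  𝟎⇒-embedding : {M : PointedMatroid ℓ} (f : Hom 𝟎 M) → IsEmbedding f
  𝟎⇒-embedding f = record { injective = λ _ → refl ; reflects = λ _ → loops-cl em ⊤ }

  ⇒𝟎-quotient : {M : PointedMatroid ℓ} (f : Hom M 𝟎) → IsQuotient f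
  ⇒𝟎-quotient {M} f = record
    { surjective    = λ _ → ⋆ M , refl
    ; injective-off = λ _ → inj₂ refl
    ; reflects      = λ _ → inj₁ (inj₂ refl)
    }

  isProtoExact : IsProtoExact (Mat• ℓ) (𝔐 ℓ) (𝔈 ℓ)
  isProtoExact = record
    { 𝔐-resp-≈ = λ { f≗g (S , ⋆∈S , φ , φ-iso , f≗) →
                     S , ⋆∈S , φ , φ-iso , λ x → trans (sym (f≗g x)) (f≗ x) }
    ; 𝔈-resp-≈ = λ { f≗g (S , ⋆∉S , φ , φ-iso , f≗) →
                     S , ⋆∉S , φ , φ-iso , λ x → trans (sym (f≗g x)) (f≗ x) }
    ; 𝟎        = 𝟎
    ; 𝟎-isZero = 𝟎-isZero
    ; 𝟎⇒-∈𝔐 = λ {M} f → embedding⇒𝔐 {𝟎} {M} f (𝟎⇒-embedding {M} f)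
    ; ⇒𝟎-∈𝔈 = λ {M} f → quotient⇒𝔈 {M} {𝟎} f (⇒𝟎-quotient {M} f)
    ; 𝔐-iso    = λ {A} {B} f → embedding⇒𝔐 {A} {B} f ∘ iso⇒embedding f
    ; 𝔈-iso    = λ {A} {B} f → quotient⇒𝔈 {A} {B} f ∘ iso⇒quotient f
    ; 𝔐-∙      = λ {A} {B} {C} {f} {g} f∈𝔐 g∈𝔐 → embedding⇒𝔐 {A} {C} _
        (embedding-∙ f g (𝔐⇒embedding {A} {B} f f∈𝔐) (𝔐⇒embedding {B} {C} g g∈𝔐))
    ; 𝔈-∙      = λ {A} {B} {C} {f} {g} f∈𝔈 g∈𝔈 → quotient⇒𝔈 {A} {C} _
        (quotient-∙ {A} {B} {C} f g (𝔈⇒quotient {A} {B} f f∈𝔈) (𝔈⇒quotient {B} {C} g g∈𝔈))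
    ; cartesian⇔coCartesian = λ {M} {N} {M′} {N′} i j j′ i′ i∈𝔐 i′∈𝔐 j∈𝔈 j′∈𝔈 →
        cartesian⇔coCartesian {M} {N} {M′} {N′} i j j′ i′
          (𝔐⇒embedding {M} {N} i i∈𝔐) (𝔐⇒embedding {M′} {N′} i′ i′∈𝔐)
          (𝔈⇒quotient {M} {M′} j j∈𝔈) (𝔈⇒quotient {N} {N′} j′ j′∈𝔈)
    ; completeCospan = λ {N} {M′} {N′} j′ i′ i′∈𝔐 j′∈𝔈 →
        completeCospan {N} {M′} {N′} j′ i′
          (𝔐⇒embedding {M′} {N′} i′ i′∈𝔐) (𝔈⇒quotient {N} {N′} j′ j′∈𝔈)
    ; completeSpan = λ {M} {N} {M′} i j i∈𝔐 j∈𝔈 →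
        completeSpan {M} {N} {M′} i j (𝔐⇒embedding {M} {N} i i∈𝔐) (𝔈⇒quotient {M} {M′} j j∈𝔈)
    }

theorem3p9 : (ℓ : Level) → ExcludedMiddle ℓ → IsProtoExact (Mat• ℓ) (𝔐 ℓ) (𝔈 ℓ)
theorem3p9 ℓ em = Admissible.isProtoExact em
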